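{- (Minkowski--Voronoi complex stabilization.) Let $a\ge 1$ and $\alpha\ge 1$ be integers and let $\beta,\gamma$ be integers with $$0\le \beta<\alpha a,\qquad 0\le\gamma<a,\qquad \gcd(\alpha,\beta)=1,\qquad \gcd(a,\alpha+\beta\gamma)=1 .$$ For nonnegative integers $t,u$ put $$b(t)=\alpha a t+\beta,\qquad N(t,u)=b(t)(au+\gamma)+\alpha=(\alpha a t+\beta)(au+\gamma)+\alpha,$$ and consider only parameter values $t\ge 0$ with $0<\alpha<b(t)$ (automatic for $t\ge 1$; for $t=0$ it means $\alpha<\beta$). Then: (1) ($(t,u)$-stabilization) there exist $t_0$ and $u_0$ such that for all $t>t_0$ and $u>u_0$ the complexes $MV\big(\Gamma(a,b(t),N(t,u))\big)$ and $MV\big(\Gamma(a,b(t_0),N(t_0,u_0))\big)$ are combinatorially equivalent; (2) ($t$-stabilization) for every $u\ge 0$ there exists $t_0$ such that for every $t>t_0$ the complexes $MV\big(\Gamma(a,b(t),N(t,u))\big)$ and $MV\big(\Gamma(a,b(t_0),N(t_0,u))\big)$ are combinatorially equivalent; (3) ($u$-stabilization) for every admissible $t\ge 0$ there exists $u_0$ such that for every $u>u_0$ the complexes $MV\big(\Gamma(a,b(t),N(t,u))\big)$ and $MV\big(\Gamma(a,b(t),N(t,u_0))\big)$ are combinatorially equivalent.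
   Context: For positive integers $a,b,N$ the rank-1 lattice is $\Gamma(a,b,N)=\{m_1(1,a,b)+m_2(0,N,0)+m_3(0,0,N): m_i\in\mathbb Z\}\subset\mathbb R^3$, and $|\Gamma|=\{(|x_1|,|x_2|,|x_3|):(x_1,x_2,x_3)\in\Gamma\}\setminus\{0\}\subset\mathbb R^3_{\ge0}$. For a finite set $A\subset\mathbb R^3_{\ge 0}$ let $\Pi(A)=\{(x_1,x_2,x_3): 0\le x_i\le \max\{y_i:(y_1,y_2,y_3)\in A\},\ i=1,2,3\}$. For a set $S\subset\mathbb R^3_{\ge0}$, a point $\gamma\in S$ is a Voronoi relative minimum if $\Pi(\{\gamma\})$ contains no point of $S\setminus\{\gamma\}$; $\mathrm{vrm}(S)$ denotes the set of these. A finite $F\subset \mathrm{vrm}(S)$ is minimal if $\Pi(F)$ contains no point of $\mathrm{vrm}(S)\setminus F$; $\mathfrak M_k(S)$ is the set of minimal $k$-element subsets. The Minkowski--Voronoi complex $MV(S)$ is the 2-dimensional complex whose $k$-dimensional faces are indexed by $\mathfrak M_{3-k}(S)$ ($k=0,1,2$), a face with subset $F_1$ being adjacent to a face with subset $F_2\neq F_1$ iff $F_1\subset F_2$. For a lattice $\Gamma$ with $\mathrm{vrm}(|\Gamma|)$ finite, $MV(\Gamma)$ denotes $MV(\mathrm{vrm}(|\Gamma|))$. Two such complexes are combinatorially equivalent if there is a bijection between their faces preserving dimension and adjacency (inclusion). -}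

module Defs where

open import Level using (0ℓ)
open import Data.Nat as ℕ using (ℕ; _≤_; _<_; _⊔_; _+_; _*_)
open import Data.Nat.GCD using (gcd)
open import Data.Integer as ℤ using (ℤ; +_; ∣_∣)
open import Data.Product using (Σ; _×_; _,_; ∃; ∃-syntax; proj₁; proj₂)
open import Data.List using (List; length; map; foldr)
open import Data.List.Relation.Unary.All using (All)
open import Data.List.Relation.Unary.Unique.Propositional using (Unique)
open import Data.List.Membership.Propositional using (_∈_)
open import Data.List.Relation.Binary.Subset.Propositional using (_⊆_)
open import Relation.Binary.PropositionalEquality using (_≡_; _≢_)
open import Relation.Nullary using (¬_)
open import Relation.Unary using (Pred)
open import Function.Bundles using (_⇔_)

-- Points of ℝ³_{≥0} that can occur: all coordinates are nonnegative integers.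
Pt : Set
Pt = ℕ × ℕ × ℕ

origin : Pt
origin = 0 , 0 , 0

-- The rank-1 lattice Γ(a,b,N) = { m1(1,a,b) + m2(0,N,0) + m3(0,0,N) } ⊂ ℤ³ ⊂ ℝ³.
InΓ : ℕ → ℕ → ℕ → Pred (ℤ × ℤ × ℤ) 0ℓ
InΓ a b N (x₁ , x₂ , x₃) =
  ∃[ m₁ ] ∃[ m₂ ] ∃[ m₃ ]
    ( x₁ ≡ m₁
    × x₂ ≡ m₁ ℤ.* + a ℤ.+ m₂ ℤ.* + N
    × x₃ ≡ m₁ ℤ.* + b ℤ.+ m₃ ℤ.* + N )

AbsΓ : ℕ → ℕ → ℕ → Pred Pt 0ℓ
AbsΓ a b N (y₁ , y₂ , y₃) =
  (∃[ x₁ ] ∃[ x₂ ] ∃[ x₃ ]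
     ( InΓ a b N (x₁ , x₂ , x₃)
     × ∣ x₁ ∣ ≡ y₁ × ∣ x₂ ∣ ≡ y₂ × ∣ x₃ ∣ ≡ y₃ ))
  × (y₁ , y₂ , y₃) ≢ origin

_≤ᵖ_ : Pt → Pt → Set
(y₁ , y₂ , y₃) ≤ᵖ (g₁ , g₂ , g₃) = y₁ ≤ g₁ × y₂ ≤ g₂ × y₃ ≤ g₃

maxPt : List Pt → Pt
maxPt = foldr (λ { (p₁ , p₂ , p₃) (q₁ , q₂ , q₃) → (p₁ ⊔ q₁ , p₂ ⊔ q₂ , p₃ ⊔ q₃) }) origin

InBox : List Pt → Pt → Set
InBox F y = y ≤ᵖ maxPt F

VRM : Pred Pt 0ℓ → Pred Pt 0ℓ
VRM S γ = S γ × (∀ y → S y → y ≤ᵖ γ → y ≡ γ)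

IsMinimal : Pred Pt 0ℓ → ℕ → List Pt → Set
IsMinimal S k F =
  length F ≡ k × Unique F × All (VRM S) F
  × (∀ y → VRM S y → InBox F y → y ∈ F)

-- Faces of the Minkowski–Voronoi complex MV(S): minimal subsets of size
-- k ∈ {1,2,3}; such a face has dimension 3 - k.
Face : Pred Pt 0ℓ → Set
Face S = Σ ℕ λ k → 1 ≤ k × k ≤ 3 × Σ (List Pt) (IsMinimal S k)

faceSet : ∀ {S} → Face S → List Pt
faceSet (_ , _ , _ , F , _) = F

faceSize : ∀ {S} → Face S → ℕ
faceSize (k , _) = k

_≈F_ : ∀ {S} → Face S → Face S → Set
x ≈F y = faceSet x ⊆ faceSet y × faceSet y ⊆ faceSet x

Adj : ∀ {S} → Face S → Face S → Set
Adj x y = faceSet x ⊆ faceSet y × ¬ (x ≈F y)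

CombEquiv : Pred Pt 0ℓ → Pred Pt 0ℓ → Set
CombEquiv S T =
  Σ (Face S → Face T) λ f → Σ (Face T → Face S) λ g →
    (∀ x y → x ≈F y → f x ≈F f y)
    × (∀ x y → x ≈F y → g x ≈F g y)
    × (∀ x → g (f x) ≈F x)
    × (∀ y → f (g y) ≈F y)
    × (∀ x → faceSize (f x) ≡ faceSize x)
    × (∀ x y → Adj x y ⇔ Adj (f x) (f y))

MVEquiv : (ℕ × ℕ × ℕ) → (ℕ × ℕ × ℕ) → Set
MVEquiv (a , b , N) (a' , b' , N') = CombEquiv (VRM (AbsΓ a b N)) (VRM (AbsΓ a' b' N'))

bₜ : ℕ → ℕ → ℕ → ℕ → ℕ
bₜ a α β t = α * a * t + β

Nₜᵤ : ℕ → ℕ → ℕ → ℕ → ℕ → ℕ → ℕ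
Nₜᵤ a α β γ t u = bₜ a α β t * (a * u + γ) + α

Admissible : ℕ → ℕ → ℕ → ℕ → Set
Admissible a α β t = 0 < α × α < bₜ a α β t

params : ℕ → ℕ → ℕ → ℕ → ℕ → ℕ → ℕ × ℕ × ℕ
params a α β γ t u = a , bₜ a α β t , Nₜᵤ a α β γ t u

{-# OPTIONS --safe #-}
module Submission where

-- Write v = a u + γ, b = b(t), N = N(t , u) = b v + α.  Every lattice point is
--   p (1 , a , b) + q (v , v a , - α) + r (0 , N , 0),
-- and identities such as N p = α x + v z (Cramer's rule) show that each
-- nonzero point of |Γ| dominates coordinatewise a nonzero candidate from a list
-- whose length does not depend on t and u: after a translation of (p , q) that
-- is linear in t or u, the coefficients are bounded by a constant K(a , α , β , γ).
-- The coordinates of the candidates are combinations of 1, u, t v (for x and y)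
-- or of 1, t, u b (for z).  These monomials are linearly ordered by growth, so
-- all comparisons between coordinates of candidates are eventually constant.
-- The relative minima are the minima of the candidate list, and MV depends
-- only on the coordinatewise order of the candidates.

open import Defs
open import Level using (0ℓ)
open import Data.Nat as ℕ using (ℕ; zero; suc; _≤_; _<_; _+_; _*_; _⊔_; z≤n; s≤s)
open import Data.Nat.GCD using (gcd)
open import Data.Nat.Properties
import Data.Nat.Tactic.RingSolver as ℕ-Ring
open import Data.Integer as ℤ using (ℤ; +_; -[1+_]; ∣_∣)
import Data.Integer.Properties as ℤ
open import Data.Integer.Tactic.RingSolver using (solve-∀)
open import Data.List using (List; []; _∷_; map; _++_; upTo; cartesianProduct)
open import Data.List.Properties using (length-map)
open import Data.List.Membership.Propositional using (_∈_)
open import Data.List.Membership.Propositional.Properties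
  using (∈-map⁺; ∈-++⁺ˡ; ∈-++⁺ʳ; ∈-upTo⁺; ∈-cartesianProduct⁺)
open import Data.List.Relation.Binary.Subset.Propositional using (_⊆_)
open import Data.List.Relation.Binary.Subset.Propositional.Properties using () renaming (map⁺ to ⊆-map⁺)
open import Data.List.Relation.Unary.All as All using (All; []; _∷_)
import Data.List.Relation.Unary.All.Properties as All
open import Data.List.Relation.Unary.AllPairs using ([]; _∷_)
open import Data.List.Relation.Unary.Any using (here; there)
open import Data.List.Relation.Unary.Unique.Propositional using (Unique)
open import Data.Product using (_×_; _,_; ∃-syntax; proj₁; proj₂)
open import Data.Product.Properties using (≡-dec)
open import Data.Sum as Sum using (_⊎_; inj₁; inj₂; [_,_]′)
open import Function using (_∘_)
open import Function.Bundles using (mk⇔)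
open import Relation.Binary using (DecidableEquality)
open import Relation.Binary.PropositionalEquality
  using (_≡_; _≢_; refl; sym; trans; cong; cong₂; subst; subst₂; module ≡-Reasoning)
open import Relation.Nullary using (¬_; yes; no; contradiction)
open import Relation.Unary using (Pred)

-- Points compared one coordinate at a time.

data Axis : Set where
  X Y Z : Axis

coord : Axis → Pt → ℕ
coord X (x , y , z) = x
coord Y (x , y , z) = y
coord Z (x , y , z) = z

coord-≡ : ∀ {P Q : Pt} → (∀ k → coord k P ≡ coord k Q) → P ≡ Q
coord-≡ h = cong₂ _,_ (h X) (cong₂ _,_ (h Y) (h Z))

≤ᵖ⇒coord : ∀ {P Q} → P ≤ᵖ Q → ∀ k → coord k P ≤ coord k Q
≤ᵖ⇒coord (x , y , z) X = x
≤ᵖ⇒coord (x , y , z) Y = y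
≤ᵖ⇒coord (x , y , z) Z = z

coord⇒≤ᵖ : ∀ {P Q} → (∀ k → coord k P ≤ coord k Q) → P ≤ᵖ Q
coord⇒≤ᵖ h = h X , h Y , h Z

_≟ᵖ_ : DecidableEquality Pt
_≟ᵖ_ = ≡-dec _≟_ (≡-dec _≟_ _≟_)

coord-maxPt-∷ : ∀ k P F → coord k (maxPt (P ∷ F)) ≡ coord k P ⊔ coord k (maxPt F)
coord-maxPt-∷ X P F = refl
coord-maxPt-∷ Y P F = refl
coord-maxPt-∷ Z P F = refl

-- Transfer of the complex along an order isomorphism of candidate lists

-- `I` and `L` are the same for all parameters, so that sets can be compared index by index. The
-- index `o` of the origin turns the vanishing of a candidate into order relations, which then
-- transfer.
record Presentation {I : Set} (L : List I) (o : I) (S : Pred Pt 0ℓ) : Set where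
  field
    pt      : I → Pt
    origin-index : pt o ≡ origin
    o∈L     : o ∈ L
    nonzero : ∀ {y} → S y → y ≢ origin
    member  : ∀ i → pt i ≢ origin → S (pt i)
    cover   : ∀ {y} → S y → ∃[ i ] (i ∈ L × pt i ≢ origin × pt i ≤ᵖ y)

  VRM-index : ∀ {y} → VRM S y → ∃[ i ] (i ∈ L × pt i ≡ y)
  VRM-index (Sy , min) with cover Sy
  ... | i , i∈L , i≢0 , i≤y = i , i∈L , min _ (member i i≢0) i≤y

open Presentation

-- `MVEquiv` feeds `VRM S` to `Face`, where `IsMinimal` applies `VRM` once more.
VRM-idem : ∀ {S y} → VRM S y → VRM (VRM S) y
VRM-idem v = v , λ y vy → proj₂ v y (proj₁ vy)

-- Axis by axis, not via `≤ᵖ`: the box of several points takes its three maxima from possibly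
-- different points.
Respects : ∀ {I : Set} {L : List I} {o S T} → Presentation L o S → Presentation L o T → Set
Respects {I} {L} A B = ∀ k {i j} → i ∈ L → j ∈ L
  → coord k (pt A i) ≤ coord k (pt A j) → coord k (pt B i) ≤ coord k (pt B j)

module Transfer {I : Set} {L : List I} {o : I} {S T : Pred Pt 0ℓ}
  (A : Presentation L o S) (B : Presentation L o T)
  (A→B : Respects A B) (B→A : Respects B A) where

  respects-≡ : ∀ {i j} → i ∈ L → j ∈ L → pt A i ≡ pt A j → pt B i ≡ pt B j
  respects-≡ i∈L j∈L e = coord-≡ λ k →
    ≤-antisym (A→B k i∈L j∈L (≤-reflexive (cong (coord k) e)))
              (A→B k j∈L i∈L (≤-reflexive (cong (coord k) (sym e))))

  search : List I → Pt → Pt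
  -- A default never reached at relative minima, all of which are listed by `VRM-index`.
  search []      y = origin
  search (i ∷ M) y with pt A i ≟ᵖ y
  ... | yes _ = pt B i
  ... | no  _ = search M y

  φ : Pt → Pt
  φ = search L

  φ-pt : ∀ {i} → i ∈ L → φ (pt A i) ≡ pt B i
  φ-pt {i} i∈L = go L (λ j∈L → j∈L) i∈L
    where
    go : ∀ M → M ⊆ L → i ∈ M → search M (pt A i) ≡ pt B i
    go (j ∷ M) M⊆L i∈M with pt A j ≟ᵖ pt A i
    ... | yes e = respects-≡ (M⊆L (here refl)) i∈L e
    go (j ∷ M) M⊆L (here refl) | no ne = contradiction refl ne
    go (j ∷ M) M⊆L (there i∈M) | no ne = go M (M⊆L ∘ there) i∈M

  -- A point of `T` below `pt B i` dominates some candidate `j`. In `A`, `j` then lies below the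
  -- minimum `i`, hence gives the same point; carried back to `B`, this forces the point of `T` to
  -- be `pt B i`.
  pt-VRM : ∀ {i} → i ∈ L → VRM S (pt A i) → VRM T (pt B i)
  pt-VRM {i} i∈L (Si , min) = member B i i≢0 , least
    where
    o→0 : ∀ {j} → j ∈ L → pt B j ≡ origin → pt A j ≡ origin
    o→0 j∈L e = trans (coord-≡ λ k →
      let e' = cong (coord k) (trans e (sym (origin-index B))) in
      ≤-antisym (B→A k j∈L (o∈L A) (≤-reflexive e'))
                (B→A k (o∈L A) j∈L (≤-reflexive (sym e')))) (origin-index A)
    0→o : ∀ {j} → j ∈ L → pt A j ≡ origin → pt B j ≡ origin
    0→o j∈L e = trans (respects-≡ j∈L (o∈L A) (trans e (sym (origin-index A)))) (origin-index B)
    i≢0 : pt B i ≢ origin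
    i≢0 e = nonzero A Si (o→0 i∈L e)
    least : ∀ y → T y → y ≤ᵖ pt B i → y ≡ pt B i
    least y Ty y≤i with cover B Ty
    ... | j , j∈L , j≢0 , j≤y = coord-≡ λ k →
      ≤-antisym (≤ᵖ⇒coord y≤i k)
                (≤-trans (A→B k i∈L j∈L (≤-reflexive (cong (coord k) (sym i≡j)))) (≤ᵖ⇒coord j≤y k))
      where
      i≡j : pt A j ≡ pt A i
      i≡j = min _ (member A j (j≢0 ∘ 0→o j∈L))
        (coord⇒≤ᵖ λ k → B→A k j∈L i∈L (≤-trans (≤ᵖ⇒coord j≤y k) (≤ᵖ⇒coord y≤i k)))

  φ-VRM : ∀ {y} → VRM S y → VRM T (φ y)
  φ-VRM v with VRM-index A v
  ... | i , i∈L , refl = subst (VRM T) (sym (φ-pt i∈L)) (pt-VRM i∈L v)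

module _ {I : Set} {L : List I} {o : I} {S T : Pred Pt 0ℓ}
  (A : Presentation L o S) (B : Presentation L o T)
  (A→B : Respects A B) (B→A : Respects B A) where

  private
    module to = Transfer A B A→B B→A
    module from = Transfer B A B→A A→B

  inverse : ∀ {y} → VRM S y → from.φ (to.φ y) ≡ y
  inverse v with VRM-index A v
  ... | i , i∈L , refl = trans (cong from.φ (to.φ-pt i∈L)) (from.φ-pt i∈L)

  map-inverse : ∀ {F} → All (VRM S) F → map from.φ (map to.φ F) ≡ F
  map-inverse []       = refl
  map-inverse (v ∷ vs) = cong₂ _∷_ (inverse v) (map-inverse vs)

  φ-reflects-≡ : ∀ {y y'} → VRM S y → VRM S y' → to.φ y ≡ to.φ y' → y ≡ y'
  φ-reflects-≡ v v' e = trans (sym (inverse v)) (trans (cong from.φ e) (inverse v'))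

  Unique-map : ∀ {F} → All (VRM S) F → Unique F → Unique (map to.φ F)
  Unique-map []       []       = []
  Unique-map (v ∷ vs) (n ∷ ns) =
    All.map⁺ (All.zipWith (λ (v' , ne) → ne ∘ φ-reflects-≡ v v') (vs , n)) ∷ Unique-map vs ns

  -- The maximum is attained at a listed point or is the 0 of the empty list, for which `o` stands
  -- in; either way only two candidates are compared.
  coord-maxPt-map : ∀ k {j} F → j ∈ L → All (VRM S) F
    → coord k (pt B j) ≤ coord k (maxPt (map to.φ F)) → coord k (pt A j) ≤ coord k (maxPt F)
  coord-maxPt-map k [] j∈L [] le =
    subst (λ w → coord k (pt A _) ≤ coord k w) (origin-index A)
      (B→A k j∈L (o∈L A) (subst (λ w → coord k (pt B _) ≤ coord k w) (sym (origin-index B)) le))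
  coord-maxPt-map k {j} (f ∷ F) j∈L (v ∷ vs) le
    rewrite coord-maxPt-∷ k (to.φ f) (map to.φ F) | coord-maxPt-∷ k f F
    with VRM-index A v | ⊔-sel (coord k (to.φ f)) (coord k (maxPt (map to.φ F)))
  ... | i , i∈L , refl | inj₁ e = ≤-trans
        (B→A k j∈L i∈L (subst (λ w → coord k (pt B j) ≤ coord k w) (to.φ-pt i∈L) (≤-trans le (≤-reflexive e))))
        (m≤m⊔n _ _)
  ... | _ | inj₂ e = ≤-trans (coord-maxPt-map k F j∈L vs (≤-trans le (≤-reflexive e))) (m≤n⊔m (coord k f) _)

  IsMinimal-map : ∀ {n F} → IsMinimal (VRM S) n F → IsMinimal (VRM T) n (map to.φ F)
  IsMinimal-map {n} {F} (len , uniq , vrm , closed) =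
    trans (length-map to.φ F) len , Unique-map vs uniq ,
    All.map⁺ (All.map (VRM-idem ∘ to.φ-VRM) vs) , closed'
    where
    vs : All (VRM S) F
    vs = All.map proj₁ vrm
    closed' : ∀ y → VRM (VRM T) y → InBox (map to.φ F) y → y ∈ map to.φ F
    closed' y (v , _) box with VRM-index B v
    ... | j , j∈L , refl = subst (_∈ map to.φ F) (to.φ-pt j∈L) (∈-map⁺ to.φ
      (closed (pt A j) (VRM-idem (from.pt-VRM j∈L v))
        (coord⇒≤ᵖ λ k → coord-maxPt-map k F j∈L vs (≤ᵖ⇒coord box k))))

  face-map : Face (VRM S) → Face (VRM T)
  face-map (n , 1≤n , n≤3 , F , m) = n , 1≤n , n≤3 , map to.φ F , IsMinimal-map m

face-VRM : ∀ {S} (x : Face (VRM S)) → All (VRM S) (faceSet x)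
face-VRM (_ , _ , _ , _ , _ , _ , vrm , _) = All.map proj₁ vrm

≡⇒≈F : ∀ {F G : List Pt} → F ≡ G → F ⊆ G × G ⊆ F
≡⇒≈F refl = (λ m → m) , (λ m → m)

Respects⇒CombEquiv : ∀ {I : Set} {L : List I} {o S T}
  (A : Presentation L o S) (B : Presentation L o T)
  → Respects A B → Respects B A → CombEquiv (VRM S) (VRM T)
Respects⇒CombEquiv {S = S} {T} A B A→B B→A =
  f , g ,
  (λ x y (p , q) → ⊆-map⁺ _ p , ⊆-map⁺ _ q) ,
  (λ x y (p , q) → ⊆-map⁺ _ p , ⊆-map⁺ _ q) ,
  (λ x → ≡⇒≈F (gf x)) ,
  (λ y → ≡⇒≈F (map-inverse B A B→A A→B (face-VRM y))) ,
  (λ x → refl) ,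
  λ x y → mk⇔
    (λ (s , ne) → ⊆-map⁺ _ s , λ (p , q) → ne (reflects x y p , reflects y x q))
    (λ (s , ne) → reflects x y s , λ (p , q) → ne (⊆-map⁺ _ p , ⊆-map⁺ _ q))
  where
  f : Face (VRM S) → Face (VRM T)
  f = face-map A B A→B B→A
  g : Face (VRM T) → Face (VRM S)
  g = face-map B A B→A A→B
  gf : ∀ x → faceSet (g (f x)) ≡ faceSet x
  gf x = map-inverse A B A→B B→A (face-VRM x)
  reflects : ∀ x y → faceSet (f x) ⊆ faceSet (f y) → faceSet x ⊆ faceSet y
  reflects x y s with p ← ⊆-map⁺ (Transfer.φ B A B→A A→B) s rewrite gf x | gf y = p

-- Eventual stability of order relations

Region : Set₁
Region = ℕ → ℕ → ℕ → Set

Eventually : Region → (ℕ → ℕ → Set) → Set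
Eventually D P = ∃[ s ] ∀ {t u} → D s t u → P t u

-- Constructive substitute for "P is eventually true or eventually false".
Stable : Region → (ℕ → ℕ → Set) → Set
Stable D P = ∃[ s ] ∀ {t u t' u'} → D s t u → D s t' u' → P t u → P t' u'

Stable-always : ∀ {D P} → Eventually D P → Stable D P
Stable-always (s , p) = s , λ _ d' _ → p d'

Stable-never : ∀ {D P} → Eventually D (λ t u → ¬ P t u) → Stable D P
Stable-never (s , ¬p) = s , λ d _ p → contradiction p (¬p d)

Stable-⇔ : ∀ {D P Q} → (∀ {t u} → P t u → Q t u) → (∀ {t u} → Q t u → P t u) → Stable D P → Stable D Q
Stable-⇔ f g (s , st) = s , λ d d' q → f (st d d' (g q))

i≤+∣i∣ : ∀ i → i ℤ.≤ + ∣ i ∣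
i≤+∣i∣ (+ _)    = ℤ.≤-refl
i≤+∣i∣ -[1+ _ ] = ℤ.-≤+

dominant-pos : ∀ i k M → ∣ i ∣ < M → ℤ.0ℤ ℤ.< i ℤ.+ + suc k ℤ.* + M
dominant-pos i k M i<M = begin-strict
  ℤ.0ℤ                            ≡⟨ ℤ.+-inverseʳ i ⟨
  i ℤ.+ ℤ.- i                     ≤⟨ ℤ.+-monoʳ-≤ i (i≤+∣i∣ (ℤ.- i)) ⟩
  i ℤ.+ + ∣ ℤ.- i ∣               ≡⟨ cong (λ n → i ℤ.+ + n) (ℤ.∣-i∣≡∣i∣ i) ⟩
  i ℤ.+ + ∣ i ∣                   <⟨ ℤ.+-monoʳ-< i (ℤ.+<+ (≤-trans i<M (m≤n*m M (suc k)))) ⟩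
  i ℤ.+ + (suc k * M)             ≡⟨ cong (ℤ._+_ i) (ℤ.pos-* (suc k) M) ⟩
  i ℤ.+ + suc k ℤ.* + M           ∎
  where open ℤ.≤-Reasoning

dominant-neg : ∀ i k M → ∣ i ∣ < M → ¬ (ℤ.0ℤ ℤ.≤ i ℤ.+ -[1+ k ] ℤ.* + M)
dominant-neg i k M i<M = ℤ.<⇒≱ (begin-strict
  i ℤ.+ -[1+ k ] ℤ.* + M                ≡⟨ eq i (+ suc k) (+ M) ⟩
  ℤ.- (ℤ.- i ℤ.+ + suc k ℤ.* + M)       <⟨ ℤ.neg-mono-< (dominant-pos (ℤ.- i) k M (subst (_< M) (sym (ℤ.∣-i∣≡∣i∣ i)) i<M)) ⟩
  ℤ.0ℤ                                  ∎)
  where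
  open ℤ.≤-Reasoning
  eq : ∀ i d m → i ℤ.+ ℤ.- d ℤ.* m ≡ ℤ.- (ℤ.- i ℤ.+ d ℤ.* m)
  eq = solve-∀

-- Once `g` exceeds `∣ f ∣`, a nonzero `d` decides the sign, so the inequality always holds or
-- always fails. Only `d = 0` falls back on `f`; monomials are thus stripped off in order of
-- decreasing growth.
Stable-dominant : ∀ {D} (f : ℕ → ℕ → ℤ) d (g : ℕ → ℕ → ℕ)
  → Eventually D (λ t u → ∣ f t u ∣ < g t u)
  → Stable D (λ t u → ℤ.0ℤ ℤ.≤ f t u)
  → Stable D (λ t u → ℤ.0ℤ ℤ.≤ f t u ℤ.+ d ℤ.* + g t u)
Stable-dominant f (+ zero) g _ st =
  Stable-⇔ (subst (ℤ.0ℤ ℤ.≤_) (sym (ℤ.+-identityʳ _))) (subst (ℤ.0ℤ ℤ.≤_) (ℤ.+-identityʳ _)) st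
Stable-dominant f (+ suc k) g (s , f<g) _ =
  Stable-always (s , λ {t} {u} d → ℤ.<⇒≤ (dominant-pos (f t u) k (g t u) (f<g d)))
Stable-dominant f -[1+ k ] g (s , f<g) _ =
  Stable-never (s , λ {t} {u} d → dominant-neg (f t u) k (g t u) (f<g d))

Stable-affine : ∀ {D} (x : ℕ → ℕ → ℕ) c d
  → (∀ s {t u} → D s t u → s ≤ x t u) → Stable D (λ t u → ℤ.0ℤ ℤ.≤ c ℤ.+ d ℤ.* + x t u)
Stable-affine x c d large = Stable-dominant (λ _ _ → c) d x (suc ∣ c ∣ , large _) (0 , λ _ _ p → p)

-- Forms in the growth monomials, and the three limits.

Coeffs : Set
Coeffs = ℤ × ℤ × ℤ

-- With `(w , s) = (u , t)`, `A = a`, `B = γ` the monomials are 1, `u`, `t v`, as needed for `x` and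
-- `y`; with `(w , s) = (t , u)`, `A = α a`, `B = β` they are 1, `t`, `u b`, as needed for `z`.
form : ℕ → ℕ → Coeffs → ℕ → ℕ → ℤ
form A B (c₀ , c₁ , c₂) w s = c₀ ℤ.+ c₁ ℤ.* + w ℤ.+ c₂ ℤ.* + (s * (A * w + B))

form-linearʳ : ∀ A B c₀ c₁ c₂ w s
  → form A B (c₀ , c₁ , c₂) w s ≡ (c₀ ℤ.+ c₁ ℤ.* + w) ℤ.+ c₂ ℤ.* + (A * w + B) ℤ.* + s
form-linearʳ A B c₀ c₁ c₂ w s = cong (ℤ._+_ (c₀ ℤ.+ c₁ ℤ.* + w))
  (trans (cong (ℤ._*_ c₂) (ℤ.pos-* s _)) (eq c₂ (+ s) _))
  where
  eq : ∀ c s n → c ℤ.* (s ℤ.* n) ≡ c ℤ.* n ℤ.* s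
  eq = solve-∀

form-linearˡ : ∀ A B c₀ c₁ c₂ w s
  → form A B (c₀ , c₁ , c₂) w s ≡ (c₀ ℤ.+ c₂ ℤ.* + (s * B)) ℤ.+ (c₁ ℤ.+ c₂ ℤ.* + (s * A)) ℤ.* + w
form-linearˡ A B c₀ c₁ c₂ w s = trans
  (cong (λ m → c₀ ℤ.+ c₁ ℤ.* + w ℤ.+ c₂ ℤ.* m) expand)
  (eq c₀ c₁ c₂ (+ w) (+ (s * A)) (+ (s * B)))
  where
  expand : + (s * (A * w + B)) ≡ + (s * A) ℤ.* + w ℤ.+ + (s * B)
  expand = begin
    + (s * (A * w + B))                   ≡⟨ cong +_ (*-distribˡ-+ s (A * w) B) ⟩
    + (s * (A * w) + s * B)               ≡⟨ cong (λ n → + (n + s * B)) (*-assoc s A w) ⟨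
    + (s * A * w + s * B)                 ≡⟨ cong (ℤ._+ + (s * B)) (ℤ.pos-* (s * A) w) ⟩
    + (s * A) ℤ.* + w ℤ.+ + (s * B)       ∎
    where open ≡-Reasoning
  eq : ∀ c₀ c₁ c₂ w p q → c₀ ℤ.+ c₁ ℤ.* w ℤ.+ c₂ ℤ.* (p ℤ.* w ℤ.+ q)
       ≡ (c₀ ℤ.+ c₂ ℤ.* q) ℤ.+ (c₁ ℤ.+ c₂ ℤ.* p) ℤ.* w
  eq = solve-∀

-- `Beyond s` is the tail of a limit with threshold `s`; the three claims are three instances.
-- `stable-form` has two halves because `t` and `u` swap roles between the forms for `x`, `y` and
-- those for `z`.
record Direction : Set₁ where
  field
    Beyond      : Region
    antitone    : ∀ {s s' t u} → s ≤ s' → Beyond s' t u → Beyond s t u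
    stable-form : ∀ A B c → 1 ≤ A
      → Stable Beyond (λ t u → ℤ.0ℤ ℤ.≤ form A B c u t) × Stable Beyond (λ t u → ℤ.0ℤ ℤ.≤ form A B c t u)

-- One factor absorbs the constant and the other the slope: `c + d w < (d + 1) w ≤ s w`, and
-- `w ≤ A w + B`.
affine<product : ∀ {A} B c d {w s} → 1 ≤ A → c + d < w → c + d < s → c + d * w < s * (A * w + B)
affine<product {A} B c d {w} {s} 1≤A <w <s = begin-strict
  c + d * w        ≤⟨ +-monoˡ-≤ (d * w) (m≤m+n c d) ⟩
  c + d + d * w    <⟨ +-monoˡ-≤ (d * w) <w ⟩
  suc d * w        ≤⟨ *-monoˡ-≤ w (≤-trans (s≤s (m≤n+m d c)) <s) ⟩
  s * w            ≤⟨ *-monoʳ-≤ s (m≤n*m w A {{ℕ.>-nonZero 1≤A}}) ⟩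
  s * (A * w)      ≤⟨ *-monoʳ-≤ s (m≤m+n _ B) ⟩
  s * (A * w + B)  ∎
  where open ≤-Reasoning

∣affine∣<product : ∀ {A} B c d {w s} → 1 ≤ A → ∣ c ∣ + ∣ d ∣ < w → ∣ c ∣ + ∣ d ∣ < s
  → ∣ c ℤ.+ d ℤ.* + w ∣ < s * (A * w + B)
∣affine∣<product B c d {w} 1≤A <w <s = ≤-<-trans
  (≤-trans (ℤ.∣i+j∣≤∣i∣+∣j∣ c _) (≤-reflexive (cong (ℕ._+_ ∣ c ∣) (ℤ.abs-* d (+ w)))))
  (affine<product B ∣ c ∣ ∣ d ∣ 1≤A <w <s)

-- Domination is used twice: the product beats the affine part, then the linear term beats the
-- constant.
both-large : Direction
both-large = record
  { Beyond = λ s t u → s ≤ t × s ≤ u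
  ; antitone = λ le (p , q) → ≤-trans le p , ≤-trans le q
  ; stable-form = λ A B (c₀ , c₁ , c₂) 1≤A →
      Stable-dominant (λ t u → c₀ ℤ.+ c₁ ℤ.* + u) c₂ (λ t u → t * (A * u + B))
        (suc (∣ c₀ ∣ + ∣ c₁ ∣) , λ (p , q) → ∣affine∣<product B c₀ c₁ 1≤A q p)
        (Stable-affine (λ t u → u) c₀ c₁ λ _ → proj₂) ,
      Stable-dominant (λ t u → c₀ ℤ.+ c₁ ℤ.* + t) c₂ (λ t u → u * (A * t + B))
        (suc (∣ c₀ ∣ + ∣ c₁ ∣) , λ (p , q) → ∣affine∣<product B c₀ c₁ 1≤A p q)
        (Stable-affine (λ t u → t) c₀ c₁ λ _ → proj₁)
  }

Stable-cong : ∀ {D} {f g : ℕ → ℕ → ℤ} → (∀ {s t u} → D s t u → f t u ≡ g t u)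
  → Stable D (λ t u → ℤ.0ℤ ℤ.≤ f t u) → Stable D (λ t u → ℤ.0ℤ ℤ.≤ g t u)
Stable-cong e (s , st) = s , λ d d' p →
  subst (ℤ.0ℤ ℤ.≤_) (e d') (st d d' (subst (ℤ.0ℤ ℤ.≤_) (sym (e d)) p))

Stable-form-fixed-w : ∀ {D} (x : ℕ → ℕ → ℕ) → (∀ s {t u} → D s t u → s ≤ x t u)
  → ∀ A B c w → Stable D (λ t u → ℤ.0ℤ ℤ.≤ form A B c w (x t u))
Stable-form-fixed-w x large A B (c₀ , c₁ , c₂) w =
  Stable-cong (λ {_} {t} {u} _ → sym (form-linearʳ A B c₀ c₁ c₂ w (x t u)))
    (Stable-affine x (c₀ ℤ.+ c₁ ℤ.* + w) (c₂ ℤ.* + (A * w + B)) large)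

Stable-form-fixed-s : ∀ {D} (x : ℕ → ℕ → ℕ) → (∀ s {t u} → D s t u → s ≤ x t u)
  → ∀ A B c s → Stable D (λ t u → ℤ.0ℤ ℤ.≤ form A B c (x t u) s)
Stable-form-fixed-s x large A B (c₀ , c₁ , c₂) s =
  Stable-cong (λ {_} {t} {u} _ → sym (form-linearˡ A B c₀ c₁ c₂ (x t u) s))
    (Stable-affine x (c₀ ℤ.+ c₂ ℤ.* + (s * B)) (c₁ ℤ.+ c₂ ℤ.* + (s * A)) large)

-- The equation `u ≡ u₀` in `Beyond` freezes one variable, so both forms become affine in `t`, which
-- sits in slot `s` of one and slot `w` of the other.
t-large : ℕ → Direction
t-large u₀ = record
  { Beyond = λ s t u → s ≤ t × u ≡ u₀
  ; antitone = λ le (p , q) → ≤-trans le p , q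
  ; stable-form = λ A B c _ →
      Stable-cong (λ { (_ , refl) → refl }) (Stable-form-fixed-w (λ t u → t) (λ _ → proj₁) A B c u₀) ,
      Stable-cong (λ { (_ , refl) → refl }) (Stable-form-fixed-s (λ t u → t) (λ _ → proj₁) A B c u₀)
  }

u-large : ℕ → Direction
u-large t₀ = record
  { Beyond = λ s t u → t ≡ t₀ × s ≤ u
  ; antitone = λ le (p , q) → p , ≤-trans le q
  ; stable-form = λ A B c _ →
      Stable-cong (λ { (refl , _) → refl }) (Stable-form-fixed-s (λ t u → u) (λ _ → proj₂) A B c t₀) ,
      Stable-cong (λ { (refl , _) → refl }) (Stable-form-fixed-w (λ t u → u) (λ _ → proj₂) A B c t₀)
  }

-- Comparison of absolute values of forms.

∣∣-≤ : ∀ {f g} → f ℤ.≤ g → ℤ.- f ℤ.≤ g → ∣ f ∣ ≤ ∣ g ∣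
∣∣-≤ {+ _}      (ℤ.+≤+ p) _         = p
∣∣-≤ { -[1+ _ ]} _        (ℤ.+≤+ p) = p

-- Stability is available for signs of forms only, so a comparison of absolute values is rewritten
-- as a combination of linear inequalities, with one alternative for each sign of `g`.
∣∣-≤-split : ∀ f g → ∣ f ∣ ≤ ∣ g ∣
  → (f ℤ.≤ g × ℤ.- f ℤ.≤ g) ⊎ (f ℤ.≤ ℤ.- g × ℤ.- f ℤ.≤ ℤ.- g)
∣∣-≤-split f g le = Sum.map bounded bounded (ℤ.+∣i∣≡i⊎+∣i∣≡-i g)
  where
  bounded : ∀ {h} → + ∣ g ∣ ≡ h → f ℤ.≤ h × ℤ.- f ℤ.≤ h
  bounded refl = ℤ.≤-trans (i≤+∣i∣ f) (ℤ.+≤+ le) ,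
    ℤ.≤-trans (i≤+∣i∣ (ℤ.- f)) (ℤ.+≤+ (≤-trans (≤-reflexive (ℤ.∣-i∣≡∣i∣ f)) le))

∣∣-≤-join : ∀ f g
  → (f ℤ.≤ g × ℤ.- f ℤ.≤ g) ⊎ (f ℤ.≤ ℤ.- g × ℤ.- f ℤ.≤ ℤ.- g) → ∣ f ∣ ≤ ∣ g ∣
∣∣-≤-join f g (inj₁ (p , q)) = ∣∣-≤ p q
∣∣-≤-join f g (inj₂ (p , q)) = subst (∣ f ∣ ≤_) (ℤ.∣-i∣≡∣i∣ g) (∣∣-≤ p q)

-ᶜ_ : Coeffs → Coeffs
-ᶜ (c₀ , c₁ , c₂) = ℤ.- c₀ , ℤ.- c₁ , ℤ.- c₂

_-ᶜ_ : Coeffs → Coeffs → Coeffs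
(c₀ , c₁ , c₂) -ᶜ (d₀ , d₁ , d₂) = c₀ ℤ.- d₀ , c₁ ℤ.- d₁ , c₂ ℤ.- d₂

form-neg : ∀ A B c w s → form A B (-ᶜ c) w s ≡ ℤ.- form A B c w s
form-neg A B (c₀ , c₁ , c₂) w s = eq c₀ c₁ c₂ (+ w) _
  where
  eq : ∀ c₀ c₁ c₂ w m → ℤ.- c₀ ℤ.+ ℤ.- c₁ ℤ.* w ℤ.+ ℤ.- c₂ ℤ.* m ≡ ℤ.- (c₀ ℤ.+ c₁ ℤ.* w ℤ.+ c₂ ℤ.* m)
  eq = solve-∀

form-sub : ∀ A B c d w s → form A B (c -ᶜ d) w s ≡ form A B c w s ℤ.- form A B d w s
form-sub A B (c₀ , c₁ , c₂) (d₀ , d₁ , d₂) w s = eq c₀ c₁ c₂ d₀ d₁ d₂ (+ w) _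
  where
  eq : ∀ c₀ c₁ c₂ d₀ d₁ d₂ w m →
    (c₀ ℤ.- d₀) ℤ.+ (c₁ ℤ.- d₁) ℤ.* w ℤ.+ (c₂ ℤ.- d₂) ℤ.* m
    ≡ (c₀ ℤ.+ c₁ ℤ.* w ℤ.+ c₂ ℤ.* m) ℤ.- (d₀ ℤ.+ d₁ ℤ.* w ℤ.+ d₂ ℤ.* m)
  eq = solve-∀

module Stability (Dir : Direction) where
  open Direction Dir

  Stable-× : ∀ {P Q} → Stable Beyond P → Stable Beyond Q → Stable Beyond (λ t u → P t u × Q t u)
  Stable-× (s , p) (s' , q) = s ⊔ s' , λ d d' (x , y) →
    p (antitone (m≤m⊔n s s') d) (antitone (m≤m⊔n s s') d') x ,
    q (antitone (m≤n⊔m s s') d) (antitone (m≤n⊔m s s') d') y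

  Stable-⊎ : ∀ {P Q} → Stable Beyond P → Stable Beyond Q → Stable Beyond (λ t u → P t u ⊎ Q t u)
  Stable-⊎ (s , p) (s' , q) = s ⊔ s' , λ d d' → Sum.map
    (p (antitone (m≤m⊔n s s') d) (antitone (m≤m⊔n s s') d'))
    (q (antitone (m≤n⊔m s s') d) (antitone (m≤n⊔m s s') d'))

  Stable-uniform : ∀ {J : Set} {P : J → ℕ → ℕ → Set} (M : List J) → (∀ j → Stable Beyond (P j))
    → ∃[ s ] ∀ {t u t' u'} → Beyond s t u → Beyond s t' u' → ∀ {j} → j ∈ M → P j t u → P j t' u'
  Stable-uniform [] st = 0 , λ _ _ ()
  Stable-uniform (i ∷ M) st with st i | Stable-uniform M st
  ... | s , p | s' , q = s ⊔ s' , λ where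
    d d' (here refl) → p (antitone (m≤m⊔n s s') d) (antitone (m≤m⊔n s s') d')
    d d' (there j∈M) → q (antitone (m≤n⊔m s s') d) (antitone (m≤n⊔m s s') d') j∈M

  Stable-∣∣≤ : (F : Coeffs → ℕ → ℕ → ℤ)
    → (∀ c t u → F (-ᶜ c) t u ≡ ℤ.- F c t u)
    → (∀ c d t u → F (c -ᶜ d) t u ≡ F c t u ℤ.- F d t u)
    → (∀ c → Stable Beyond (λ t u → ℤ.0ℤ ℤ.≤ F c t u))
    → ∀ c d → Stable Beyond (λ t u → ∣ F c t u ∣ ≤ ∣ F d t u ∣)
  Stable-∣∣≤ F neg sub stable c d =
    Stable-⇔ (∣∣-≤-join _ _) (∣∣-≤-split _ _)
      (Stable-⊎
        (Stable-× (leq c d) (Stable-cast (λ t u → neg c t u) (λ _ _ → refl) (leq (-ᶜ c) d)))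
        (Stable-× (Stable-cast (λ _ _ → refl) (λ t u → neg d t u) (leq c (-ᶜ d)))
                  (Stable-cast (λ t u → neg c t u) (λ t u → neg d t u) (leq (-ᶜ c) (-ᶜ d)))))
    where
    leq : ∀ c d → Stable Beyond (λ t u → F c t u ℤ.≤ F d t u)
    leq c d = Stable-⇔
      (λ {t} {u} p → ℤ.0≤i-j⇒j≤i (subst (ℤ.0ℤ ℤ.≤_) (sub d c t u) p))
      (λ {t} {u} p → subst (ℤ.0ℤ ℤ.≤_) (sym (sub d c t u)) (ℤ.i≤j⇒0≤j-i p))
      (stable (d -ᶜ c))
    Stable-cast : ∀ {f f' g g' : ℕ → ℕ → ℤ} → (∀ t u → f t u ≡ f' t u) → (∀ t u → g t u ≡ g' t u)
      → Stable Beyond (λ t u → f t u ℤ.≤ g t u) → Stable Beyond (λ t u → f' t u ℤ.≤ g' t u)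
    Stable-cast e e' (s , st) = s , λ {t} {u} {t'} {u'} d d' p →
      subst₂ ℤ._≤_ (e t' u') (e' t' u') (st d d' (subst₂ ℤ._≤_ (sym (e t u)) (sym (e' t u)) p))

-- The candidates and the covering of the lattice

pos-affine : ∀ A w B → + (A * w + B) ≡ + A ℤ.* + w ℤ.+ + B
pos-affine A w B = cong (ℤ._+ + B) (ℤ.pos-* A w)

interval : ℕ → List ℤ
interval K = map +_ (upTo (suc K)) ++ map (λ n → ℤ.- + n) (upTo (suc K))

∈-interval : ∀ {K} i → ∣ i ∣ ≤ K → i ∈ interval K
∈-interval (+ n)    le = ∈-++⁺ˡ (∈-map⁺ +_ (∈-upTo⁺ (s≤s le)))
∈-interval {K} -[1+ n ] le = ∈-++⁺ʳ (map +_ (upTo (suc K))) (∈-map⁺ (λ n → ℤ.- + n) (∈-upTo⁺ (s≤s le)))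

data Kind : Set where
  smallX smallY smallZ central : Kind

kinds : List Kind
kinds = smallX ∷ smallY ∷ smallZ ∷ central ∷ []

∈-kinds : ∀ κ → κ ∈ kinds
∈-kinds smallX  = here refl
∈-kinds smallY  = there (here refl)
∈-kinds smallZ  = there (there (here refl))
∈-kinds central = there (there (there (here refl)))

Index : Set
Index = Kind × ℤ × ℤ × ℤ

module Lattice (a α β γ : ℕ) where

  b : ℕ → ℕ
  b = bₜ a α β

  v : ℕ → ℕ
  v u = a * u + γ

  N : ℕ → ℕ → ℕ
  N = Nₜᵤ a α β γ

  -- The lattice point p (1 , a , b) + q (v , v a , - α) + r (0 , N , 0).
  xℤ : (u : ℕ) → ℤ → ℤ → ℤ
  xℤ u p q = p ℤ.+ q ℤ.* + v u

  yℤ : (t u : ℕ) → ℤ → ℤ → ℤ → ℤ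
  yℤ t u p q r = xℤ u p q ℤ.* + a ℤ.+ r ℤ.* + N t u

  -- Written in the shape of `InΓ` with `m₁ = x` and `m₃ = - q`, so that membership of a candidate
  -- holds by `refl`.
  zℤ : (t u : ℕ) → ℤ → ℤ → ℤ
  zℤ t u p q = xℤ u p q ℤ.* + b t ℤ.+ (ℤ.- q) ℤ.* + N t u

  -- An index stores bounded coefficients; p* and q* are the true ones.  The kind
  -- names the coordinate that stays small (|x| ≤ v, |y| ≤ a or |z| ≤ α; central
  -- means |y| ≤ a v and |z| ≤ b), and the translation is forced by this smallness.
  p* q* : ℕ → ℕ → Index → ℤ
  p* t u (smallX  , p , q , r) = p
  p* t u (smallY  , p , q , r) = p ℤ.- + u ℤ.* (+ a ℤ.* q ℤ.+ + β ℤ.* r)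
  p* t u (smallZ  , p , q , r) = p
  p* t u (central , p , q , r) = p
  q* t u (smallX  , p , q , r) = q
  q* t u (smallY  , p , q , r) = q ℤ.- + α ℤ.* + t ℤ.* r
  q* t u (smallZ  , p , q , r) = q ℤ.+ + a ℤ.* + t ℤ.* p
  q* t u (central , p , q , r) = q ℤ.- + α ℤ.* + t ℤ.* r

  r* : Index → ℤ
  r* (_ , _ , _ , r) = r

  point : (t u : ℕ) → ℤ → ℤ → ℤ → Pt
  point t u p q r = ∣ xℤ u p q ∣ , ∣ yℤ t u p q r ∣ , ∣ zℤ t u p q ∣

  candidate : (t u : ℕ) → Index → Pt
  candidate t u i = point t u (p* t u i) (q* t u i) (r* i)

  coordℤ : Axis → ℕ → ℕ → Index → ℤ
  coordℤ X t u i = xℤ u (p* t u i) (q* t u i)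
  coordℤ Y t u i = yℤ t u (p* t u i) (q* t u i) (r* i)
  coordℤ Z t u i = zℤ t u (p* t u i) (q* t u i)

  -- Obtained by substituting `p*` and `q*` and expanding. In `smallY` the translation of `p`
  -- cancels the term `q a u` of `x`; in `smallZ` that of `q` cancels all growth of `z`. The
  -- summands with `r` in `yCoeffs` come from expanding `N` in 1, `u`, `t v`.
  xCoeffs yCoeffs zCoeffs : Index → Coeffs
  xCoeffs (κ , p , q , r) = p ℤ.+ q ℤ.* + γ , linear κ , leading κ
    where
    linear leading : Kind → ℤ
    linear smallY  = ℤ.- (+ β ℤ.* r)
    linear _       = q ℤ.* + a
    leading smallX = ℤ.0ℤ
    leading smallZ = + a ℤ.* p
    leading _      = ℤ.- (+ α ℤ.* r)
  yCoeffs i = let c₀ , c₁ , c₂ = xCoeffs i ; r = r* i in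
    c₀ ℤ.* + a ℤ.+ r ℤ.* (+ β ℤ.* + γ ℤ.+ + α) ,
    c₁ ℤ.* + a ℤ.+ r ℤ.* (+ β ℤ.* + a) ,
    c₂ ℤ.* + a ℤ.+ r ℤ.* (+ α ℤ.* + a)
  zCoeffs (κ , p , q , r) = + β ℤ.* p ℤ.- + α ℤ.* q , linear κ , leading κ
    where
    linear leading : Kind → ℤ
    linear smallX  = + α ℤ.* + a ℤ.* p
    linear smallZ  = ℤ.0ℤ
    linear _       = + α ℤ.* (+ a ℤ.* p ℤ.+ + α ℤ.* r)
    leading smallY = ℤ.- (+ a ℤ.* q ℤ.+ + β ℤ.* r)
    leading _      = ℤ.0ℤ

  pos-b : ∀ t → + b t ≡ + α ℤ.* + a ℤ.* + t ℤ.+ + β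
  pos-b t = trans (pos-affine (α * a) t β) (cong (λ n → n ℤ.* + t ℤ.+ + β) (ℤ.pos-* α a))

  pos-N : ∀ t u → + N t u ≡ + b t ℤ.* + v u ℤ.+ + α
  pos-N t u = pos-affine (b t) (v u) α

  module _ (t u : ℕ) where
    x-form : ∀ i → coordℤ X t u i ≡ form a γ (xCoeffs i) u t
    x-form (κ , p , q , r) = by-kind κ (pos-affine a u γ) (ℤ.pos-* t (v u))
      where
      -- The casts of natural numbers are generalized to `V` and `W`; matching `refl` then leaves a
      -- polynomial identity for the ring solver. The `expand` helpers below use the same device.
      by-kind : ∀ κ {V W} → V ≡ + a ℤ.* + u ℤ.+ + γ → W ≡ + t ℤ.* V →
        let c₀ , c₁ , c₂ = xCoeffs (κ , p , q , r) in
        p* t u (κ , p , q , r) ℤ.+ q* t u (κ , p , q , r) ℤ.* V ≡ c₀ ℤ.+ c₁ ℤ.* + u ℤ.+ c₂ ℤ.* W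
      by-kind smallX {W = W} refl _ = eq p q (+ a) (+ u) (+ γ) W
        where
        eq : ∀ p q a u γ W → p ℤ.+ q ℤ.* (a ℤ.* u ℤ.+ γ)
          ≡ p ℤ.+ q ℤ.* γ ℤ.+ q ℤ.* a ℤ.* u ℤ.+ ℤ.0ℤ ℤ.* W
        eq = solve-∀
      by-kind smallY refl refl = eq p q r (+ a) (+ α) (+ β) (+ γ) (+ t) (+ u)
        where
        eq : ∀ p q r a α β γ t u →
          (p ℤ.- u ℤ.* (a ℤ.* q ℤ.+ β ℤ.* r)) ℤ.+ (q ℤ.- α ℤ.* t ℤ.* r) ℤ.* (a ℤ.* u ℤ.+ γ)
          ≡ p ℤ.+ q ℤ.* γ ℤ.+ ℤ.- (β ℤ.* r) ℤ.* u ℤ.+ ℤ.- (α ℤ.* r) ℤ.* (t ℤ.* (a ℤ.* u ℤ.+ γ))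
        eq = solve-∀
      by-kind smallZ refl refl = eq p q (+ a) (+ γ) (+ t) (+ u)
        where
        eq : ∀ p q a γ t u → p ℤ.+ (q ℤ.+ a ℤ.* t ℤ.* p) ℤ.* (a ℤ.* u ℤ.+ γ)
          ≡ p ℤ.+ q ℤ.* γ ℤ.+ q ℤ.* a ℤ.* u ℤ.+ a ℤ.* p ℤ.* (t ℤ.* (a ℤ.* u ℤ.+ γ))
        eq = solve-∀
      by-kind central refl refl = eq p q r (+ a) (+ α) (+ γ) (+ t) (+ u)
        where
        eq : ∀ p q r a α γ t u → p ℤ.+ (q ℤ.- α ℤ.* t ℤ.* r) ℤ.* (a ℤ.* u ℤ.+ γ)
          ≡ p ℤ.+ q ℤ.* γ ℤ.+ q ℤ.* a ℤ.* u ℤ.+ ℤ.- (α ℤ.* r) ℤ.* (t ℤ.* (a ℤ.* u ℤ.+ γ))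
        eq = solve-∀

    pos-N-form : + N t u ≡ + β ℤ.* + γ ℤ.+ + α ℤ.+ + β ℤ.* + a ℤ.* + u ℤ.+ + α ℤ.* + a ℤ.* + (t * v u)
    pos-N-form = trans (pos-N t u) (expand (pos-b t) (pos-affine a u γ) (ℤ.pos-* t (v u)))
      where
      eq : ∀ a α β γ t u → (α ℤ.* a ℤ.* t ℤ.+ β) ℤ.* (a ℤ.* u ℤ.+ γ) ℤ.+ α
        ≡ β ℤ.* γ ℤ.+ α ℤ.+ β ℤ.* a ℤ.* u ℤ.+ α ℤ.* a ℤ.* (t ℤ.* (a ℤ.* u ℤ.+ γ))
      eq = solve-∀
      expand : ∀ {B V W} → B ≡ + α ℤ.* + a ℤ.* + t ℤ.+ + β → V ≡ + a ℤ.* + u ℤ.+ + γ → W ≡ + t ℤ.* V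
        → B ℤ.* V ℤ.+ + α ≡ + β ℤ.* + γ ℤ.+ + α ℤ.+ + β ℤ.* + a ℤ.* + u ℤ.+ + α ℤ.* + a ℤ.* W
      expand refl refl refl = eq (+ a) (+ α) (+ β) (+ γ) (+ t) (+ u)

    y-form : ∀ i → coordℤ Y t u i ≡ form a γ (yCoeffs i) u t
    y-form i = trans (cong₂ (λ x n → x ℤ.* + a ℤ.+ r* i ℤ.* n) (x-form i) pos-N-form)
      (eq (proj₁ (xCoeffs i)) (proj₁ (proj₂ (xCoeffs i))) (proj₂ (proj₂ (xCoeffs i)))
          (r* i) (+ a) (+ α) (+ β) (+ γ) (+ u) (+ (t * v u)))
      where
      eq : ∀ c₀ c₁ c₂ r a α β γ u W →
        (c₀ ℤ.+ c₁ ℤ.* u ℤ.+ c₂ ℤ.* W) ℤ.* a ℤ.+ r ℤ.* (β ℤ.* γ ℤ.+ α ℤ.+ β ℤ.* a ℤ.* u ℤ.+ α ℤ.* a ℤ.* W)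
        ≡ (c₀ ℤ.* a ℤ.+ r ℤ.* (β ℤ.* γ ℤ.+ α)) ℤ.+ (c₁ ℤ.* a ℤ.+ r ℤ.* (β ℤ.* a)) ℤ.* u
          ℤ.+ (c₂ ℤ.* a ℤ.+ r ℤ.* (α ℤ.* a)) ℤ.* W
      eq = solve-∀

    -- As `N = b v + α`, the terms `q b v` cancel.
    zℤ-basis : ∀ p q → zℤ t u p q ≡ + b t ℤ.* p ℤ.- + α ℤ.* q
    zℤ-basis p q = expand (pos-N t u)
      where
      eq : ∀ p q B V α → (p ℤ.+ q ℤ.* V) ℤ.* B ℤ.+ (ℤ.- q) ℤ.* (B ℤ.* V ℤ.+ α) ≡ B ℤ.* p ℤ.- α ℤ.* q
      eq = solve-∀
      expand : ∀ {n} → n ≡ + b t ℤ.* + v u ℤ.+ + α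
        → (p ℤ.+ q ℤ.* + v u) ℤ.* + b t ℤ.+ (ℤ.- q) ℤ.* n ≡ + b t ℤ.* p ℤ.- + α ℤ.* q
      expand refl = eq p q (+ b t) (+ v u) (+ α)

    z-form : ∀ i → coordℤ Z t u i ≡ form (α * a) β (zCoeffs i) t u
    z-form (κ , p , q , r) = trans (zℤ-basis _ _) (by-kind κ (pos-b t) (ℤ.pos-* u (b t)))
      where
      by-kind : ∀ κ {B W} → B ≡ + α ℤ.* + a ℤ.* + t ℤ.+ + β → W ≡ + u ℤ.* B →
        let c₀ , c₁ , c₂ = zCoeffs (κ , p , q , r) in
        B ℤ.* p* t u (κ , p , q , r) ℤ.- + α ℤ.* q* t u (κ , p , q , r) ≡ c₀ ℤ.+ c₁ ℤ.* + t ℤ.+ c₂ ℤ.* W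
      by-kind smallX {W = W} refl _ = eq p q (+ a) (+ α) (+ β) (+ t) W
        where
        eq : ∀ p q a α β t W → (α ℤ.* a ℤ.* t ℤ.+ β) ℤ.* p ℤ.- α ℤ.* q
          ≡ β ℤ.* p ℤ.- α ℤ.* q ℤ.+ α ℤ.* a ℤ.* p ℤ.* t ℤ.+ ℤ.0ℤ ℤ.* W
        eq = solve-∀
      by-kind smallY refl refl = eq p q r (+ a) (+ α) (+ β) (+ t) (+ u)
        where
        eq : ∀ p q r a α β t u →
          (α ℤ.* a ℤ.* t ℤ.+ β) ℤ.* (p ℤ.- u ℤ.* (a ℤ.* q ℤ.+ β ℤ.* r)) ℤ.- α ℤ.* (q ℤ.- α ℤ.* t ℤ.* r)
          ≡ β ℤ.* p ℤ.- α ℤ.* q ℤ.+ α ℤ.* (a ℤ.* p ℤ.+ α ℤ.* r) ℤ.* t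
            ℤ.+ ℤ.- (a ℤ.* q ℤ.+ β ℤ.* r) ℤ.* (u ℤ.* (α ℤ.* a ℤ.* t ℤ.+ β))
        eq = solve-∀
      by-kind smallZ {W = W} refl _ = eq p q (+ a) (+ α) (+ β) (+ t) W
        where
        eq : ∀ p q a α β t W → (α ℤ.* a ℤ.* t ℤ.+ β) ℤ.* p ℤ.- α ℤ.* (q ℤ.+ a ℤ.* t ℤ.* p)
          ≡ β ℤ.* p ℤ.- α ℤ.* q ℤ.+ ℤ.0ℤ ℤ.* t ℤ.+ ℤ.0ℤ ℤ.* W
        eq = solve-∀
      by-kind central {W = W} refl _ = eq p q r (+ a) (+ α) (+ β) (+ t) W
        where
        eq : ∀ p q r a α β t W → (α ℤ.* a ℤ.* t ℤ.+ β) ℤ.* p ℤ.- α ℤ.* (q ℤ.- α ℤ.* t ℤ.* r)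
          ≡ β ℤ.* p ℤ.- α ℤ.* q ℤ.+ α ℤ.* (a ℤ.* p ℤ.+ α ℤ.* r) ℤ.* t ℤ.+ ℤ.0ℤ ℤ.* W
        eq = solve-∀

-- Coefficient bounds from Cramer-type identities.

∣∣-cancel : ∀ {n p w} C → 0 < n → + n ℤ.* p ≡ w → ∣ w ∣ ≤ C * n → ∣ p ∣ ≤ C
∣∣-cancel {n} {p} C 0<n refl le = *-cancelʳ-≤ ∣ p ∣ C n {{ℕ.>-nonZero 0<n}}
  (≤-trans (≤-reflexive (trans (*-comm ∣ p ∣ n) (sym (ℤ.abs-* (+ n) p)))) le)

∣scaled∣ : ∀ A x {C n} → A * ∣ x ∣ ≤ C * n → ∣ + A ℤ.* x ∣ ≤ C * n
∣scaled∣ A x = ≤-trans (≤-reflexive (ℤ.abs-* (+ A) x))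

-- Bounds are kept as multiples of the `n` that `∣∣-cancel` divides out, which leaves a constant
-- free of `t` and `u`.
∣sum∣ : ∀ A x B y C D {n} → A * ∣ x ∣ ≤ C * n → B * ∣ y ∣ ≤ D * n
  → ∣ + A ℤ.* x ℤ.+ + B ℤ.* y ∣ ≤ (C + D) * n
∣sum∣ A x B y C D {n} p q = ≤-trans (ℤ.∣i+j∣≤∣i∣+∣j∣ (+ A ℤ.* x) (+ B ℤ.* y))
  (≤-trans (+-mono-≤ (∣scaled∣ A x {C} p) (∣scaled∣ B y {D} q)) (≤-reflexive (sym (*-distribʳ-+ n C D))))

∣difference∣ : ∀ A x B y C D {n} → A * ∣ x ∣ ≤ C * n → B * ∣ y ∣ ≤ D * n
  → ∣ + A ℤ.* x ℤ.- + B ℤ.* y ∣ ≤ (C + D) * n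
∣difference∣ A x B y C D {n} p q = ≤-trans (ℤ.∣i-j∣≤∣i∣+∣j∣ (+ A ℤ.* x) (+ B ℤ.* y))
  (≤-trans (+-mono-≤ (∣scaled∣ A x {C} p) (∣scaled∣ B y {D} q)) (≤-reflexive (sym (*-distribʳ-+ n C D))))

1*≤ : ∀ {m n} → m ≤ n → 1 * m ≤ n
1*≤ {m} = ≤-trans (≤-reflexive (*-identityˡ m))

≢origin : ∀ k {P} → 0 < coord k P → P ≢ origin
≢origin X () refl
≢origin Y () refl
≢origin Z () refl

module Cover (a α β γ : ℕ) (1≤a : 1 ≤ a) (1≤α : 1 ≤ α) where
  open Lattice a α β γ

  -- A sum that is at least every coefficient bound below, among them `1 + a` for `r`, `2 + 2 α` and
  -- `1 + 2 γ + 2 α` for the stored `p`, and `2 + 2 β` for the stored `q`. In `≤K` the argument `o`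
  -- is the slack.
  K : ℕ
  K = 2 + a + (α + α) + (β + β) + (γ + γ)

  ≤K : ∀ {m n} o → m ≤ n → n + o ≡ K → m ≤ K
  ≤K o m≤n e = ≤-trans m≤n (≤-trans (m≤m+n _ o) (≤-reflexive e))

  candidates : List Index
  candidates = cartesianProduct kinds
    (cartesianProduct (interval K) (cartesianProduct (interval K) (interval K)))

  ∈-candidates : ∀ κ p q r → ∣ p ∣ ≤ K → ∣ q ∣ ≤ K → ∣ r ∣ ≤ K → (κ , p , q , r) ∈ candidates
  ∈-candidates κ p q r p≤ q≤ r≤ = ∈-cartesianProduct⁺ (∈-kinds κ)
    (∈-cartesianProduct⁺ (∈-interval p p≤) (∈-cartesianProduct⁺ (∈-interval q q≤) (∈-interval r r≤)))

  module _ (t u : ℕ) (α<b : α < b t) where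

    Dominated : Pt → Set
    Dominated P = ∃[ i ] (i ∈ candidates × candidate t u i ≢ origin × candidate t u i ≤ᵖ P)

    private
      B V M : ℕ
      B = b t
      V = v u
      M = N t u

    0<M : 0 < M
    0<M = ≤-trans 1≤α (m≤n+m α (B * V))

    0<B : 0 < B
    0<B = ≤-trans (s≤s z≤n) α<b

    BV≤M : B * V ≤ M
    BV≤M = m≤m+n (B * V) α

    V≤M : V ≤ M
    V≤M = ≤-trans (m≤n*m V B {{ℕ.>-nonZero 0<B}}) BV≤M

    αV≤M : α * V ≤ M
    αV≤M = ≤-trans (*-monoˡ-≤ V (<⇒≤ α<b)) BV≤M

    -- For `v = 0` the modulus drops to `α < b`, hence the condition on `V`.
    B≤M : 0 < V → B ≤ M
    B≤M 0<V = ≤-trans (m≤m*n B V {{ℕ.>-nonZero 0<V}}) BV≤M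

    module _ (p q r : ℤ) where
      private
        x = xℤ u p q
        y = yℤ t u p q r
        z = zℤ t u p q
        -- `P` and `Q` are combinations from which `x` is eliminated, so that `y` and `z` alone
        -- bound them. `q'` undoes the translation that `q*` makes for `smallY` and `central`.
        P = + a ℤ.* p ℤ.+ + α ℤ.* r
        Q = + a ℤ.* q ℤ.+ + B ℤ.* r
        q' = q ℤ.+ + α ℤ.* + t ℤ.* r

      -- Cramer's rule for `x = p + q V`, `z = B p - α q`, whose determinant is `- M`; `M*q` is the
      -- other component.
      M*p : + M ℤ.* p ≡ + α ℤ.* x ℤ.+ + V ℤ.* z
      M*p = expand (pos-N t u)
        where
        eq : ∀ p q α B V → (B ℤ.* V ℤ.+ α) ℤ.* p
          ≡ α ℤ.* (p ℤ.+ q ℤ.* V) ℤ.+ V ℤ.* ((p ℤ.+ q ℤ.* V) ℤ.* B ℤ.+ ℤ.- q ℤ.* (B ℤ.* V ℤ.+ α))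
        eq = solve-∀
        expand : ∀ {n} → n ≡ + B ℤ.* + V ℤ.+ + α → n ℤ.* p ≡ + α ℤ.* x ℤ.+ + V ℤ.* (x ℤ.* + B ℤ.+ ℤ.- q ℤ.* n)
        expand refl = eq p q (+ α) (+ B) (+ V)

      M*q : + M ℤ.* q ≡ + B ℤ.* x ℤ.- + 1 ℤ.* z
      M*q = eq q (+ B) x (+ M)
        where
        eq : ∀ q B x M → M ℤ.* q ≡ B ℤ.* x ℤ.- + 1 ℤ.* (x ℤ.* B ℤ.+ ℤ.- q ℤ.* M)
        eq = solve-∀

      M*r : + M ℤ.* r ≡ + 1 ℤ.* y ℤ.- + a ℤ.* x
      M*r = eq r (+ a) x (+ M)
        where
        eq : ∀ r a x M → M ℤ.* r ≡ + 1 ℤ.* (x ℤ.* a ℤ.+ r ℤ.* M) ℤ.- a ℤ.* x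
        eq = solve-∀

      -- In `a` times the identity for `p` plus `α` times the one for `r`, the terms in `x` cancel.
      -- `M*Q` arises likewise from `q` and `r`, with `B` in place of `α`.
      M*P : + M ℤ.* P ≡ + α ℤ.* y ℤ.+ + (a * V) ℤ.* z
      M*P = expand M*p (ℤ.pos-* a V)
        where
        eq : ∀ p r x z a α V M → M ℤ.* (a ℤ.* p ℤ.+ α ℤ.* r) ≡ a ℤ.* (M ℤ.* p) ℤ.+ α ℤ.* r ℤ.* M
        eq = solve-∀
        eq′ : ∀ r x z a α V M → a ℤ.* (α ℤ.* x ℤ.+ V ℤ.* z) ℤ.+ α ℤ.* r ℤ.* M
          ≡ α ℤ.* (x ℤ.* a ℤ.+ r ℤ.* M) ℤ.+ a ℤ.* V ℤ.* z
        eq′ = solve-∀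
        expand : ∀ {n} → + M ℤ.* p ≡ + α ℤ.* x ℤ.+ + V ℤ.* z → n ≡ + a ℤ.* + V → + M ℤ.* P ≡ + α ℤ.* y ℤ.+ n ℤ.* z
        expand e refl = trans (eq p r x z (+ a) (+ α) (+ V) (+ M))
          (trans (cong (λ m → + a ℤ.* m ℤ.+ + α ℤ.* r ℤ.* + M) e) (eq′ r x z (+ a) (+ α) (+ V) (+ M)))

      M*Q : + M ℤ.* Q ≡ + B ℤ.* y ℤ.- + a ℤ.* z
      M*Q = eq q r x (+ a) (+ B) (+ M)
        where
        eq : ∀ q r x a B M → M ℤ.* (a ℤ.* q ℤ.+ B ℤ.* r)
          ≡ B ℤ.* (x ℤ.* a ℤ.+ r ℤ.* M) ℤ.- a ℤ.* (x ℤ.* B ℤ.+ ℤ.- q ℤ.* M)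
        eq = solve-∀

      a*p : + a ℤ.* p ≡ + 1 ℤ.* P ℤ.- + α ℤ.* r
      a*p = eq p r (+ a) (+ α)
        where
        eq : ∀ p r a α → a ℤ.* p ≡ + 1 ℤ.* (a ℤ.* p ℤ.+ α ℤ.* r) ℤ.- α ℤ.* r
        eq = solve-∀

      -- `α a t = b - β` absorbs the translation, so bounds on `Q` and `r` bound `q'`.
      a*q' : + a ℤ.* q' ≡ + 1 ℤ.* Q ℤ.- + β ℤ.* r
      a*q' = expand (pos-b t)
        where
        eq : ∀ q r a α β t → a ℤ.* (q ℤ.+ α ℤ.* t ℤ.* r)
          ≡ + 1 ℤ.* (a ℤ.* q ℤ.+ (α ℤ.* a ℤ.* t ℤ.+ β) ℤ.* r) ℤ.- β ℤ.* r
        eq = solve-∀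
        expand : ∀ {n} → n ≡ + α ℤ.* + a ℤ.* + t ℤ.+ + β
          → + a ℤ.* q' ≡ + 1 ℤ.* (+ a ℤ.* q ℤ.+ n ℤ.* r) ℤ.- + β ℤ.* r
        expand refl = eq q r (+ a) (+ α) (+ β) (+ t)

      α*s : + α ℤ.* (q ℤ.- + a ℤ.* + t ℤ.* p) ≡ + β ℤ.* p ℤ.- + 1 ℤ.* z
      α*s = expand (zℤ-basis t u p q) (pos-b t)
        where
        eq : ∀ p q a α β t → α ℤ.* (q ℤ.- a ℤ.* t ℤ.* p)
          ≡ β ℤ.* p ℤ.- + 1 ℤ.* ((α ℤ.* a ℤ.* t ℤ.+ β) ℤ.* p ℤ.- α ℤ.* q)
        eq = solve-∀
        expand : ∀ {n z} → z ≡ n ℤ.* p ℤ.- + α ℤ.* q → n ≡ + α ℤ.* + a ℤ.* + t ℤ.+ + β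
          → + α ℤ.* (q ℤ.- + a ℤ.* + t ℤ.* p) ≡ + β ℤ.* p ℤ.- + 1 ℤ.* z
        expand refl refl = eq p q (+ a) (+ α) (+ β) (+ t)

      -- Here `a q' + β r = Q` and `y = a p + v Q + α r`. Since `v = a u + γ`, the shift of `p` by
      -- `u Q` removes all of the growing term `v Q` except `γ Q`.
      a*s : + a ℤ.* (p ℤ.+ + u ℤ.* (+ a ℤ.* q' ℤ.+ + β ℤ.* r))
        ≡ + 1 ℤ.* (+ 1 ℤ.* y ℤ.- + γ ℤ.* Q) ℤ.- + α ℤ.* r
      a*s = expand (pos-b t) (pos-affine a u γ) (pos-N t u)
        where
        eq : ∀ p q r a α β γ t u →
          a ℤ.* (p ℤ.+ u ℤ.* (a ℤ.* (q ℤ.+ α ℤ.* t ℤ.* r) ℤ.+ β ℤ.* r))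
          ≡ + 1 ℤ.* (+ 1 ℤ.* ((p ℤ.+ q ℤ.* (a ℤ.* u ℤ.+ γ)) ℤ.* a
              ℤ.+ r ℤ.* ((α ℤ.* a ℤ.* t ℤ.+ β) ℤ.* (a ℤ.* u ℤ.+ γ) ℤ.+ α))
            ℤ.- γ ℤ.* (a ℤ.* q ℤ.+ (α ℤ.* a ℤ.* t ℤ.+ β) ℤ.* r)) ℤ.- α ℤ.* r
        eq = solve-∀
        expand : ∀ {n w m} → n ≡ + α ℤ.* + a ℤ.* + t ℤ.+ + β → w ≡ + a ℤ.* + u ℤ.+ + γ → m ≡ n ℤ.* w ℤ.+ + α
          → + a ℤ.* (p ℤ.+ + u ℤ.* (+ a ℤ.* q' ℤ.+ + β ℤ.* r))
            ≡ + 1 ℤ.* (+ 1 ℤ.* ((p ℤ.+ q ℤ.* w) ℤ.* + a ℤ.+ r ℤ.* m)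
              ℤ.- + γ ℤ.* (+ a ℤ.* q ℤ.+ n ℤ.* r)) ℤ.- + α ℤ.* r
        expand refl refl refl = eq p q r (+ a) (+ α) (+ β) (+ γ) (+ t) (+ u)

      self : ∀ i → i ∈ candidates → p* t u i ≡ p → q* t u i ≡ q → r* i ≡ r
        → point t u p q r ≢ origin → Dominated (point t u p q r)
      self i i∈ refl refl refl nz = i , i∈ , nz , ≤-refl , ≤-refl , ≤-refl

      r-bound : ∣ x ∣ ≤ M → ∣ y ∣ ≤ M → ∣ r ∣ ≤ 1 + a
      r-bound x≤M y≤M = ∣∣-cancel (1 + a) 0<M M*r
        (∣difference∣ 1 y a x 1 a (*-monoʳ-≤ 1 y≤M) (*-monoʳ-≤ a x≤M))

      module _ (nz : point t u p q r ≢ origin) (r≤ : ∣ r ∣ ≤ 1 + a) where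

        r≤K : ∣ r ∣ ≤ K
        r≤K = ≤K (1 + (α + α) + (β + β) + (γ + γ)) r≤ (eq a α β γ)
          where
          eq : ∀ a α β γ → 1 + a + (1 + (α + α) + (β + β) + (γ + γ)) ≡ 2 + a + (α + α) + (β + β) + (γ + γ)
          eq = ℕ-Ring.solve-∀

        -- `1 ≤ a` trades `1 + a` for `2 a`, a multiple of the `a` that is divided out of `a*p`,
        -- `a*q'` and `a*s`.
        scaled-r≤ : ∀ n → n * ∣ r ∣ ≤ (n + n) * a
        scaled-r≤ n = begin
          n * ∣ r ∣      ≤⟨ *-monoʳ-≤ n r≤ ⟩
          n * (1 + a)    ≤⟨ *-monoʳ-≤ n (+-monoˡ-≤ a 1≤a) ⟩
          n * (a + a)    ≡⟨ eq n a ⟩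
          (n + n) * a    ∎
          where
          open ≤-Reasoning
          eq : ∀ n a → n * (a + a) ≡ (n + n) * a
          eq = ℕ-Ring.solve-∀

        q'-bound : ∣ Q ∣ ≤ a + a → ∣ q' ∣ ≤ K
        q'-bound Q≤ = ≤K (a + (α + α) + (γ + γ))
          (∣∣-cancel (2 + (β + β)) 1≤a a*q'
            (∣difference∣ 1 Q β r 2 (β + β) (1*≤ (≤-trans Q≤ (≤-reflexive (cong (_+_ a) (sym (+-identityʳ a)))))) (scaled-r≤ β)))
          (eq a α β γ)
          where
          eq : ∀ a α β γ → 2 + (β + β) + (a + (α + α) + (γ + γ)) ≡ 2 + a + (α + α) + (β + β) + (γ + γ)
          eq = ℕ-Ring.solve-∀

        self-smallX : ∣ x ∣ ≤ V → ∣ z ∣ ≤ B → 0 < V → Dominated (point t u p q r)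
        self-smallX x≤V z≤B 0<V = self (smallX , p , q , r)
          (∈-candidates smallX p q r (2≤K p≤2) (2≤K q≤2) r≤K) refl refl refl nz
          where
          p≤2 : ∣ p ∣ ≤ 2
          p≤2 = ∣∣-cancel 2 0<M M*p (∣sum∣ α x V z 1 1
            (≤-trans (*-monoʳ-≤ α x≤V) (≤-trans αV≤M (≤-reflexive (sym (*-identityˡ M)))))
            (≤-trans (*-monoʳ-≤ V z≤B) (≤-trans (≤-reflexive (*-comm V B))
              (≤-trans BV≤M (≤-reflexive (sym (*-identityˡ M)))))))
          q≤2 : ∣ q ∣ ≤ 2
          q≤2 = ∣∣-cancel 2 0<M M*q (∣difference∣ B x 1 z 1 1
            (≤-trans (*-monoʳ-≤ B x≤V) (≤-trans BV≤M (≤-reflexive (sym (*-identityˡ M)))))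
            (*-monoʳ-≤ 1 (≤-trans z≤B (B≤M 0<V))))
          2≤K : ∀ {n} → n ≤ 2 → n ≤ K
          2≤K n≤2 = ≤K (a + (α + α) + (β + β) + (γ + γ)) n≤2 (eq a α β γ)
            where
            eq : ∀ a α β γ → 2 + (a + (α + α) + (β + β) + (γ + γ)) ≡ 2 + a + (α + α) + (β + β) + (γ + γ)
            eq = ℕ-Ring.solve-∀

        -- Although `x` may reach `M`, Cramer's rule still gives `∣ p ∣ ≤ 2 α`; then `α*s` keeps `q`
        -- within bounded distance of `a t p`.
        self-smallZ : ∣ x ∣ ≤ M → ∣ z ∣ ≤ α → Dominated (point t u p q r)
        self-smallZ x≤M z≤α = self (smallZ , p , q ℤ.- + a ℤ.* + t ℤ.* p , r)
          (∈-candidates smallZ p _ r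
            (≤K (2 + a + (β + β) + (γ + γ)) p≤ (eq a α β γ))
            (≤K (1 + a + (α + α) + (γ + γ)) s≤ (eq′ a α β γ)) r≤K)
          refl (cancel q (+ a ℤ.* + t ℤ.* p)) refl nz
          where
          p≤ : ∣ p ∣ ≤ α + α
          p≤ = ∣∣-cancel (α + α) 0<M M*p (∣sum∣ α x V z α α (*-monoʳ-≤ α x≤M)
            (≤-trans (*-mono-≤ V≤M z≤α) (≤-reflexive (*-comm M α))))
          s≤ : ∣ q ℤ.- + a ℤ.* + t ℤ.* p ∣ ≤ β + β + 1
          s≤ = ∣∣-cancel (β + β + 1) 1≤α α*s (∣difference∣ β p 1 z (β + β) 1
            (≤-trans (*-monoʳ-≤ β p≤) (≤-reflexive (eq″ α β))) (*-monoʳ-≤ 1 z≤α))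
            where
            eq″ : ∀ α β → β * (α + α) ≡ (β + β) * α
            eq″ = ℕ-Ring.solve-∀
          cancel : ∀ i j → i ℤ.- j ℤ.+ j ≡ i
          cancel = solve-∀
          eq : ∀ a α β γ → α + α + (2 + a + (β + β) + (γ + γ)) ≡ 2 + a + (α + α) + (β + β) + (γ + γ)
          eq = ℕ-Ring.solve-∀
          eq′ : ∀ a α β γ → β + β + 1 + (1 + a + (α + α) + (γ + γ)) ≡ 2 + a + (α + α) + (β + β) + (γ + γ)
          eq′ = ℕ-Ring.solve-∀

        -- A small `y` bounds `Q`; `a*q'` and `a*s` then bound the stored `q` and `p`, although `p`
        -- itself may grow with `u`.
        self-smallY : ∣ y ∣ ≤ a → ∣ z ∣ ≤ M → 0 < V → Dominated (point t u p q r)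
        self-smallY y≤a z≤M 0<V = self (smallY , p ℤ.+ + u ℤ.* (+ a ℤ.* q' ℤ.+ + β ℤ.* r) , q' , r)
          (∈-candidates smallY _ q' r (≤K (1 + a + (β + β)) s≤ (eq a α β γ)) (q'-bound Q≤) r≤K)
          (cancel p (+ u ℤ.* (+ a ℤ.* q' ℤ.+ + β ℤ.* r))) (cancel q (+ α ℤ.* + t ℤ.* r)) refl nz
          where
          Q≤ : ∣ Q ∣ ≤ a + a
          Q≤ = ∣∣-cancel (a + a) 0<M M*Q (∣difference∣ B y a z a a
            (≤-trans (*-mono-≤ (B≤M 0<V) y≤a) (≤-reflexive (*-comm M a))) (*-monoʳ-≤ a z≤M))
          s≤ : ∣ p ℤ.+ + u ℤ.* (+ a ℤ.* q' ℤ.+ + β ℤ.* r) ∣ ≤ 1 + (γ + γ) + (α + α)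
          s≤ = ∣∣-cancel (1 + (γ + γ) + (α + α)) 1≤a a*s
            (∣difference∣ 1 (+ 1 ℤ.* y ℤ.- + γ ℤ.* Q) α r (1 + (γ + γ)) (α + α)
              (1*≤ (∣difference∣ 1 y γ Q 1 (γ + γ) (*-monoʳ-≤ 1 y≤a)
                (≤-trans (*-monoʳ-≤ γ Q≤) (≤-reflexive (eq′ a γ)))))
              (scaled-r≤ α))
            where
            eq′ : ∀ a γ → γ * (a + a) ≡ (γ + γ) * a
            eq′ = ℕ-Ring.solve-∀
          cancel : ∀ i j → i ℤ.+ j ℤ.- j ≡ i
          cancel = solve-∀
          eq : ∀ a α β γ → 1 + (γ + γ) + (α + α) + (1 + a + (β + β)) ≡ 2 + a + (α + α) + (β + β) + (γ + γ)
          eq = ℕ-Ring.solve-∀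

        -- Both `P` and `Q` are at most `2 a` in absolute value, so `p` stays bounded and only `q`
        -- needs a translation.
        self-central : ∣ y ∣ ≤ V * a → ∣ z ∣ ≤ B → 0 < V → Dominated (point t u p q r)
        self-central y≤ z≤B 0<V = self (central , p , q' , r)
          (∈-candidates central p q' r (≤K (a + (β + β) + (γ + γ)) p≤ (eq a α β γ)) (q'-bound Q≤) r≤K)
          refl (cancel q (+ α ℤ.* + t ℤ.* r)) refl nz
          where
          open ≤-Reasoning
          P≤ : ∣ P ∣ ≤ a + a
          P≤ = ∣∣-cancel (a + a) 0<M M*P (∣sum∣ α y (a * V) z a a
            (begin
              α * ∣ y ∣      ≤⟨ *-monoʳ-≤ α y≤ ⟩
              α * (V * a)    ≡⟨ *-assoc α V a ⟨
              α * V * a      ≤⟨ *-monoˡ-≤ a αV≤M ⟩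
              M * a          ≡⟨ *-comm M a ⟩
              a * M          ∎)
            (begin
              a * V * ∣ z ∣  ≤⟨ *-monoʳ-≤ (a * V) z≤B ⟩
              a * V * B      ≡⟨ *-assoc a V B ⟩
              a * (V * B)    ≡⟨ cong (a *_) (*-comm V B) ⟩
              a * (B * V)    ≤⟨ *-monoʳ-≤ a BV≤M ⟩
              a * M          ∎))
          Q≤ : ∣ Q ∣ ≤ a + a
          Q≤ = ∣∣-cancel (a + a) 0<M M*Q (∣difference∣ B y a z a a
            (begin
              B * ∣ y ∣      ≤⟨ *-monoʳ-≤ B y≤ ⟩
              B * (V * a)    ≡⟨ *-assoc B V a ⟨
              B * V * a      ≤⟨ *-monoˡ-≤ a BV≤M ⟩
              M * a          ≡⟨ *-comm M a ⟩
              a * M          ∎)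
            (*-monoʳ-≤ a (≤-trans z≤B (B≤M 0<V))))
          p≤ : ∣ p ∣ ≤ 2 + (α + α)
          p≤ = ∣∣-cancel (2 + (α + α)) 1≤a a*p (∣difference∣ 1 P α r 2 (α + α)
            (1*≤ (≤-trans P≤ (≤-reflexive (cong (_+_ a) (sym (+-identityʳ a)))))) (scaled-r≤ α))
          cancel : ∀ i j → i ℤ.+ j ℤ.- j ≡ i
          cancel = solve-∀
          eq : ∀ a α β γ → 2 + (α + α) + (a + (β + β) + (γ + γ)) ≡ 2 + a + (α + α) + (β + β) + (γ + γ)
          eq = ℕ-Ring.solve-∀

    dominated-by : ∀ i {x y z P} → i ∈ candidates
      → coordℤ X t u i ≡ x → coordℤ Y t u i ≡ y → coordℤ Z t u i ≡ z
      → ∀ k → 0 < coord k (∣ x ∣ , ∣ y ∣ , ∣ z ∣) → (∣ x ∣ , ∣ y ∣ , ∣ z ∣) ≤ᵖ P → Dominated P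
    dominated-by i i∈ refl refl refl k 0<k le = i , i∈ , ≢origin k 0<k , le

    x-axis : ∀ {P} → M ≤ coord X P → Dominated P
    -- The vector `(N , 0 , 0)` has `p = α`, `q = b`, `r = - a`; the stored `q` is `b - a t α = β`.
    x-axis {P} M≤x = dominated-by (smallZ , + α , + β , ℤ.- + a)
      (∈-candidates smallZ (+ α) (+ β) (ℤ.- + a)
        (≤K (2 + a + α + (β + β) + (γ + γ)) ≤-refl (eq₁ a α β γ))
        (≤K (2 + a + (α + α) + β + (γ + γ)) ≤-refl (eq₂ a α β γ))
        (≤K (2 + (α + α) + (β + β) + (γ + γ)) (≤-reflexive (ℤ.∣-i∣≡∣i∣ (+ a))) (eq₃ a α β γ)))
      x≡M
      (trans (cong (λ x → x ℤ.* + a ℤ.+ ℤ.- + a ℤ.* + M) x≡M) (eq₄ (+ a) (+ M)))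
      (trans (zℤ-basis t u _ _) (z≡0 (pos-b t)))
      X 0<M (M≤x , z≤n , z≤n)
      where
      eq₁ : ∀ a α β γ → α + (2 + a + α + (β + β) + (γ + γ)) ≡ 2 + a + (α + α) + (β + β) + (γ + γ)
      eq₁ = ℕ-Ring.solve-∀
      eq₂ : ∀ a α β γ → β + (2 + a + (α + α) + β + (γ + γ)) ≡ 2 + a + (α + α) + (β + β) + (γ + γ)
      eq₂ = ℕ-Ring.solve-∀
      eq₃ : ∀ a α β γ → a + (2 + (α + α) + (β + β) + (γ + γ)) ≡ 2 + a + (α + α) + (β + β) + (γ + γ)
      eq₃ = ℕ-Ring.solve-∀
      eq₄ : ∀ a M → M ℤ.* a ℤ.+ ℤ.- a ℤ.* M ≡ ℤ.0ℤ
      eq₄ = solve-∀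
      eq₅ : ∀ a α β t V → α ℤ.+ (β ℤ.+ a ℤ.* t ℤ.* α) ℤ.* V ≡ (α ℤ.* a ℤ.* t ℤ.+ β) ℤ.* V ℤ.+ α
      eq₅ = solve-∀
      eq₆ : ∀ a α β t → (α ℤ.* a ℤ.* t ℤ.+ β) ℤ.* α ℤ.- α ℤ.* (β ℤ.+ a ℤ.* t ℤ.* α) ≡ ℤ.0ℤ
      eq₆ = solve-∀
      x≡M : + α ℤ.+ (+ β ℤ.+ + a ℤ.* + t ℤ.* + α) ℤ.* + V ≡ + M
      x≡M = trans (eq₅ (+ a) (+ α) (+ β) (+ t) (+ V))
        (sym (trans (pos-N t u) (cong (λ n → n ℤ.* + V ℤ.+ + α) (pos-b t))))
      z≡0 : ∀ {n} → n ≡ + α ℤ.* + a ℤ.* + t ℤ.+ + β → n ℤ.* + α ℤ.- + α ℤ.* (+ β ℤ.+ + a ℤ.* + t ℤ.* + α) ≡ ℤ.0ℤ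
      z≡0 refl = eq₆ (+ a) (+ α) (+ β) (+ t)

    0≤K : 0 ≤ K
    0≤K = z≤n

    1≤K : 1 ≤ K
    1≤K = s≤s z≤n

    y-axis : ∀ {P} → M ≤ coord Y P → Dominated P
    y-axis {P} M≤y = dominated-by (smallX , ℤ.0ℤ , ℤ.0ℤ , ℤ.1ℤ)
      (∈-candidates smallX ℤ.0ℤ ℤ.0ℤ ℤ.1ℤ 0≤K 0≤K 1≤K)
      (eq₁ (+ V)) (eq₂ (+ a) (+ V) (+ M)) (eq₃ (+ B) (+ V) (+ M)) Y 0<M (z≤n , M≤y , z≤n)
      where
      eq₁ : ∀ V → ℤ.0ℤ ℤ.+ ℤ.0ℤ ℤ.* V ≡ ℤ.0ℤ
      eq₁ = solve-∀
      eq₂ : ∀ a V M → (ℤ.0ℤ ℤ.+ ℤ.0ℤ ℤ.* V) ℤ.* a ℤ.+ ℤ.1ℤ ℤ.* M ≡ M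
      eq₂ = solve-∀
      eq₃ : ∀ B V M → (ℤ.0ℤ ℤ.+ ℤ.0ℤ ℤ.* V) ℤ.* B ℤ.+ ℤ.0ℤ ℤ.* M ≡ ℤ.0ℤ
      eq₃ = solve-∀

    z-axis : ∀ {P} → M ≤ coord Z P → Dominated P
    -- The vector `(0 , 0 , N)` has `p = v`, `q = - 1`, `r = 0`; the stored `p` is `v - a u = γ`.
    z-axis {P} M≤z = dominated-by (smallY , + γ , ℤ.-1ℤ , ℤ.0ℤ)
      (∈-candidates smallY (+ γ) ℤ.-1ℤ ℤ.0ℤ
        (≤K (2 + a + (α + α) + (β + β) + γ) ≤-refl (eq₀ a α β γ)) 1≤K 0≤K)
      x≡0
      (trans (cong (λ x → x ℤ.* + a ℤ.+ ℤ.0ℤ ℤ.* + M) x≡0) (eq₂ (+ a) (+ M)))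
      (trans (cong (λ x → x ℤ.* + B ℤ.+ ℤ.- (ℤ.-1ℤ ℤ.- + α ℤ.* + t ℤ.* ℤ.0ℤ) ℤ.* + M) x≡0)
        (eq₃ (+ α) (+ t) (+ B) (+ M)))
      Z 0<M (z≤n , z≤n , M≤z)
      where
      eq₀ : ∀ a α β γ → γ + (2 + a + (α + α) + (β + β) + γ) ≡ 2 + a + (α + α) + (β + β) + (γ + γ)
      eq₀ = ℕ-Ring.solve-∀
      eq₁ : ∀ a α β γ t u → (γ ℤ.- u ℤ.* (a ℤ.* ℤ.-1ℤ ℤ.+ β ℤ.* ℤ.0ℤ))
        ℤ.+ (ℤ.-1ℤ ℤ.- α ℤ.* t ℤ.* ℤ.0ℤ) ℤ.* (a ℤ.* u ℤ.+ γ) ≡ ℤ.0ℤ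
      eq₁ = solve-∀
      eq₂ : ∀ a M → ℤ.0ℤ ℤ.* a ℤ.+ ℤ.0ℤ ℤ.* M ≡ ℤ.0ℤ
      eq₂ = solve-∀
      eq₃ : ∀ α t B M → ℤ.0ℤ ℤ.* B ℤ.+ ℤ.- (ℤ.-1ℤ ℤ.- α ℤ.* t ℤ.* ℤ.0ℤ) ℤ.* M ≡ M
      eq₃ = solve-∀
      x≡0 : (+ γ ℤ.- + u ℤ.* (+ a ℤ.* ℤ.-1ℤ ℤ.+ + β ℤ.* ℤ.0ℤ))
        ℤ.+ (ℤ.-1ℤ ℤ.- + α ℤ.* + t ℤ.* ℤ.0ℤ) ℤ.* + V ≡ ℤ.0ℤ
      x≡0 = trans (cong (λ w → (+ γ ℤ.- + u ℤ.* (+ a ℤ.* ℤ.-1ℤ ℤ.+ + β ℤ.* ℤ.0ℤ))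
          ℤ.+ (ℤ.-1ℤ ℤ.- + α ℤ.* + t ℤ.* ℤ.0ℤ) ℤ.* w) (pos-affine a u γ))
        (eq₁ (+ a) (+ α) (+ β) (+ γ) (+ t) (+ u))

    generator : ∀ {P} → 1 ≤ coord X P → a ≤ coord Y P → B ≤ coord Z P → Dominated P
    generator {P} 1≤x a≤y B≤z = dominated-by (smallX , ℤ.1ℤ , ℤ.0ℤ , ℤ.0ℤ)
      (∈-candidates smallX ℤ.1ℤ ℤ.0ℤ ℤ.0ℤ 1≤K 0≤K 0≤K)
      (eq₁ (+ V)) (eq₂ (+ a) (+ V) (+ M)) (eq₂ (+ B) (+ V) (+ M)) X (s≤s z≤n) (1≤x , a≤y , B≤z)
      where
      eq₁ : ∀ V → ℤ.1ℤ ℤ.+ ℤ.0ℤ ℤ.* V ≡ ℤ.1ℤ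
      eq₁ = solve-∀
      eq₂ : ∀ a V M → (ℤ.1ℤ ℤ.+ ℤ.0ℤ ℤ.* V) ℤ.* a ℤ.+ ℤ.0ℤ ℤ.* M ≡ a
      eq₂ = solve-∀

    second-generator : ∀ {P} → V ≤ coord X P → V * a ≤ coord Y P → α ≤ coord Z P → Dominated P
    second-generator {P} V≤x Va≤y α≤z = dominated-by (smallX , ℤ.0ℤ , ℤ.1ℤ , ℤ.0ℤ)
      (∈-candidates smallX ℤ.0ℤ ℤ.1ℤ ℤ.0ℤ 0≤K 1≤K 0≤K)
      (eq₁ (+ V)) (trans (eq₂ (+ a) (+ V) (+ M)) (sym (ℤ.pos-* V a)))
      (trans (zℤ-basis t u _ _) (eq₃ (+ α) (+ B))) Z
      (≤-trans 1≤α (≤-reflexive (sym ∣-α∣))) (V≤x , Va≤y , ≤-trans (≤-reflexive ∣-α∣) α≤z)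
      where
      ∣-α∣ : ∣ ℤ.- + α ∣ ≡ α
      ∣-α∣ = ℤ.∣-i∣≡∣i∣ (+ α)
      eq₁ : ∀ V → ℤ.0ℤ ℤ.+ ℤ.1ℤ ℤ.* V ≡ V
      eq₁ = solve-∀
      eq₂ : ∀ a V M → (ℤ.0ℤ ℤ.+ ℤ.1ℤ ℤ.* V) ℤ.* a ℤ.+ ℤ.0ℤ ℤ.* M ≡ V ℤ.* a
      eq₂ = solve-∀
      eq₃ : ∀ α B → B ℤ.* ℤ.0ℤ ℤ.- α ℤ.* ℤ.1ℤ ≡ ℤ.- α
      eq₃ = solve-∀

    -- If `x = 0`, then `y` is a multiple of `N` and cannot lie strictly between 0 and `N`. This
    -- supplies the bound `1 ≤ x` for `generator`.
    0<∣x∣ : ∀ p q r → ∣ yℤ t u p q r ∣ < M → 0 < ∣ yℤ t u p q r ∣ → 0 < ∣ xℤ u p q ∣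
    0<∣x∣ p q r y<M 0<y with xℤ u p q
    ... | + suc _  = s≤s z≤n
    ... | -[1+ _ ] = s≤s z≤n
    ... | + zero   = contradiction y<M (≤⇒≯ M≤y)
      where
      ∣y∣≡ : ∣ ℤ.0ℤ ℤ.* + a ℤ.+ r ℤ.* + M ∣ ≡ ∣ r ∣ * M
      ∣y∣≡ = trans (cong ∣_∣ (ℤ.+-identityˡ (r ℤ.* + M))) (ℤ.abs-* r (+ M))
      M≤y : M ≤ ∣ ℤ.0ℤ ℤ.* + a ℤ.+ r ℤ.* + M ∣
      M≤y = ≤-trans (m≤n*m M ∣ r ∣ {{m*n≢0⇒m≢0 ∣ r ∣ {{ℕ.>-nonZero (subst (0 <_) ∣y∣≡ 0<y)}}}})
        (≤-reflexive (sym ∣y∣≡))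

    -- A coordinate reaching `N` is handled by an axis vector. Otherwise `z < α` is `smallZ` and
    -- `y < a` is `smallY`; past these, `(1 , a , b)` lies below unless `z < b`. There `x < v` is
    -- `smallX`, and for `v ≤ x` either `(v , v a , α)` lies below or `y < v a`, which is `central`.
    cover-point : ∀ p q r → point t u p q r ≢ origin → Dominated (point t u p q r)
    cover-point p q r nz =
      [ x-axis , (λ x<M → [ y-axis , (λ y<M → [ z-axis , inside x<M y<M ]′ (≤-<-connex M z)) ]′ (≤-<-connex M y)) ]′
        (≤-<-connex M x)
      where
      x y z : ℕ
      x = ∣ xℤ u p q ∣
      y = ∣ yℤ t u p q r ∣
      z = ∣ zℤ t u p q ∣
      inside : x < M → y < M → z < M → Dominated (point t u p q r)
      inside x<M y<M z<M = [ α≤z-case , self-smallZ p q r nz r≤ (<⇒≤ x<M) ∘ <⇒≤ ]′ (≤-<-connex α z)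
        where
        r≤ : ∣ r ∣ ≤ 1 + a
        r≤ = r-bound p q r (<⇒≤ x<M) (<⇒≤ y<M)
        z<B-case : α ≤ z → z < B → Dominated (point t u p q r)
        z<B-case α≤z z<B =
          [ (λ V≤x → [ (λ Va≤y → second-generator V≤x Va≤y α≤z)
                     , (λ y<Va → self-central p q r nz r≤ (<⇒≤ y<Va) (<⇒≤ z<B)
                         (n≢0⇒n>0 λ e → n≮0 (subst (λ w → y < w * a) e y<Va)))
                     ]′ (≤-<-connex (V * a) y))
          , (λ x<V → self-smallX p q r nz r≤ (<⇒≤ x<V) (<⇒≤ z<B) (≤-<-trans z≤n x<V))
          ]′ (≤-<-connex V x)
        α≤z-case : α ≤ z → Dominated (point t u p q r)
        α≤z-case α≤z =
          [ (λ a≤y → [ generator (0<∣x∣ p q r y<M (≤-trans 1≤a a≤y)) a≤y , z<B-case α≤z ]′ (≤-<-connex B z))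
          , (λ y<a → self-smallY p q r nz r≤ (<⇒≤ y<a) (<⇒≤ z<M) 0<V)
          ]′ (≤-<-connex a y)
          where
          -- V = 0 would force N = α, hence z < α.
          0<V : 0 < V
          0<V = n≢0⇒n>0 λ e → <⇒≱ z<M (subst (_≤ z)
            (sym (trans (cong (λ w → B * w + α) e) (cong (_+ α) (*-zeroʳ B)))) α≤z)

    presentation : Presentation candidates (smallX , ℤ.0ℤ , ℤ.0ℤ , ℤ.0ℤ) (AbsΓ a (b t) (N t u))
    presentation = record
      { pt           = candidate t u
      ; origin-index = cong₂ _,_ (cong ∣_∣ (x≡0 (+ V)))
          (cong₂ _,_ (cong ∣_∣ (y≡0 (+ a) (+ V) (+ M))) (cong ∣_∣ (y≡0 (+ B) (+ V) (+ M))))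
      ; o∈L          = ∈-candidates smallX ℤ.0ℤ ℤ.0ℤ ℤ.0ℤ 0≤K 0≤K 0≤K
      ; nonzero      = proj₂
      ; member       = λ i nz → (_ , _ , _ ,
          (xℤ u (p* t u i) (q* t u i) , r* i , ℤ.- q* t u i , refl , refl , refl) , refl , refl , refl) , nz
      ; cover        = cover-AbsΓ
      }
      where
      x≡0 : ∀ V → ℤ.0ℤ ℤ.+ ℤ.0ℤ ℤ.* V ≡ ℤ.0ℤ
      x≡0 = solve-∀
      y≡0 : ∀ a V M → (ℤ.0ℤ ℤ.+ ℤ.0ℤ ℤ.* V) ℤ.* a ℤ.+ ℤ.0ℤ ℤ.* M ≡ ℤ.0ℤ
      y≡0 = solve-∀
      cover-AbsΓ : ∀ {P} → AbsΓ a (b t) (N t u) P → Dominated P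
      cover-AbsΓ ((_ , _ , _ , (m₁ , m₂ , m₃ , refl , refl , refl) , refl , refl , refl) , nz) =
        -- The coefficients solve `x = m₁`, `r = m₂`, `- q = m₃`, hence `p = m₁ + m₃ v`.
        subst Dominated same (cover-point (m₁ ℤ.+ m₃ ℤ.* + V) (ℤ.- m₃) m₂ (nz ∘ trans (sym same)))
        where
        x-eq : ∀ m₁ m₃ V → (m₁ ℤ.+ m₃ ℤ.* V) ℤ.+ ℤ.- m₃ ℤ.* V ≡ m₁
        x-eq = solve-∀
        same : point t u (m₁ ℤ.+ m₃ ℤ.* + V) (ℤ.- m₃) m₂
          ≡ (∣ m₁ ∣ , ∣ m₁ ℤ.* + a ℤ.+ m₂ ℤ.* + M ∣ , ∣ m₁ ℤ.* + B ℤ.+ m₃ ℤ.* + M ∣)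
        same = cong₂ (λ x m → ∣ x ∣ , ∣ x ℤ.* + a ℤ.+ m₂ ℤ.* + M ∣ , ∣ x ℤ.* + B ℤ.+ m ℤ.* + M ∣)
          (x-eq m₁ m₃ (+ V)) (ℤ.neg-involutive m₃)

  -- Uniform thresholds and the three stabilizations.

  module _ (Dir : Direction) where
    open Direction Dir
    open Stability Dir

    axes : List Axis
    axes = X ∷ Y ∷ Z ∷ []

    ∈-axes : ∀ k → k ∈ axes
    ∈-axes X = here refl
    ∈-axes Y = there (here refl)
    ∈-axes Z = there (there (here refl))

    Order : Axis × Index × Index → ℕ → ℕ → Set
    Order (k , i , j) t u = coord k (candidate t u i) ≤ coord k (candidate t u j)

    Stable-xy : ∀ c d → Stable Beyond (λ t u → ∣ form a γ c u t ∣ ≤ ∣ form a γ d u t ∣)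
    Stable-xy = Stable-∣∣≤ (λ c t u → form a γ c u t)
      (λ c t u → form-neg a γ c u t) (λ c d t u → form-sub a γ c d u t)
      (λ c → proj₁ (stable-form a γ c 1≤a))

    Stable-z : ∀ c d → Stable Beyond (λ t u → ∣ form (α * a) β c t u ∣ ≤ ∣ form (α * a) β d t u ∣)
    Stable-z = Stable-∣∣≤ (λ c t u → form (α * a) β c t u)
      (λ c t u → form-neg (α * a) β c t u) (λ c d t u → form-sub (α * a) β c d t u)
      (λ c → proj₂ (stable-form (α * a) β c (*-mono-≤ 1≤α 1≤a)))

    Stable-Order : ∀ kij → Stable Beyond (Order kij)
    Stable-Order (X , i , j) = Stable-⇔
      (λ {t} {u} → subst₂ (λ m n → ∣ m ∣ ≤ ∣ n ∣) (sym (x-form t u i)) (sym (x-form t u j)))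
      (λ {t} {u} → subst₂ (λ m n → ∣ m ∣ ≤ ∣ n ∣) (x-form t u i) (x-form t u j))
      (Stable-xy (xCoeffs i) (xCoeffs j))
    Stable-Order (Y , i , j) = Stable-⇔
      (λ {t} {u} → subst₂ (λ m n → ∣ m ∣ ≤ ∣ n ∣) (sym (y-form t u i)) (sym (y-form t u j)))
      (λ {t} {u} → subst₂ (λ m n → ∣ m ∣ ≤ ∣ n ∣) (y-form t u i) (y-form t u j))
      (Stable-xy (yCoeffs i) (yCoeffs j))
    Stable-Order (Z , i , j) = Stable-⇔
      (λ {t} {u} → subst₂ (λ m n → ∣ m ∣ ≤ ∣ n ∣) (sym (z-form t u i)) (sym (z-form t u j)))
      (λ {t} {u} → subst₂ (λ m n → ∣ m ∣ ≤ ∣ n ∣) (z-form t u i) (z-form t u j))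
      (Stable-z (zCoeffs i) (zCoeffs j))

    stabilization : ∃[ s ] ∀ {t u t' u'} → Beyond s t u → Beyond s t' u'
      → Admissible a α β t → Admissible a α β t'
      → MVEquiv (params a α β γ t u) (params a α β γ t' u')
    stabilization = proj₁ stable , λ {t} {u} {t'} {u'} d d' (_ , α<b) (_ , α<b') →
      Respects⇒CombEquiv (presentation t u α<b) (presentation t' u' α<b')
        -- `Stable` covers both orders of two parameter pairs in the tail, so swapping `d` and `d'`
        -- gives the converse comparison with the same threshold.
        (λ k i∈ j∈ → proj₂ stable d d' (∈-cartesianProduct⁺ (∈-axes k) (∈-cartesianProduct⁺ i∈ j∈)))
        (λ k i∈ j∈ → proj₂ stable d' d (∈-cartesianProduct⁺ (∈-axes k) (∈-cartesianProduct⁺ i∈ j∈)))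
      where
      stable = Stable-uniform (cartesianProduct axes (cartesianProduct candidates candidates)) Stable-Order

-- The bound is 2 because `b(1) = α` when `a = 1` and `β = 0`.
admissible : ∀ {a α} β {t} → 1 ≤ a → 1 ≤ α → 2 ≤ t → Admissible a α β t
admissible {a} {α} β {t} 1≤a 1≤α 2≤t = 1≤α , (begin-strict
  α              <⟨ m<m*n α 2 {{ℕ.>-nonZero 1≤α}} (s≤s (s≤s z≤n)) ⟩
  α * 2          ≤⟨ *-mono-≤ (m≤m*n α a {{ℕ.>-nonZero 1≤a}}) 2≤t ⟩
  α * a * t      ≤⟨ m≤m+n _ β ⟩
  α * a * t + β  ∎)
  where open ≤-Reasoning

theorem4p7 : (a α β γ : ℕ) → 1 ≤ a → 1 ≤ α → β < α * a → γ < a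
    → gcd α β ≡ 1 → gcd a (α + β * γ) ≡ 1
    → (∃[ t₀ ] ∃[ u₀ ] (Admissible a α β t₀
    × (∀ t u → t₀ < t → u₀ < u → Admissible a α β t
    → MVEquiv (params a α β γ t u) (params a α β γ t₀ u₀))))
    × (∀ u → ∃[ t₀ ] (Admissible a α β t₀
    × (∀ t → t₀ < t → Admissible a α β t
    → MVEquiv (params a α β γ t u) (params a α β γ t₀ u))))
    × (∀ t → Admissible a α β t → ∃[ u₀ ] (∀ u → u₀ < u
    → MVEquiv (params a α β γ t u) (params a α β γ t u₀)))
theorem4p7 a α β γ 1≤a 1≤α _ _ _ _ =
  -- Adding 2 makes the base value of `t` admissible and keeps it beyond the threshold, so the base
  -- parameters lie in the tail themselves.
  (2 + s₁ , s₁ , start s₁ , λ t u t₀<t u₀<u adm →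
    proj₂ tu-stable (≤-trans (m≤n+m s₁ 2) (<⇒≤ t₀<t) , <⇒≤ u₀<u) (m≤n+m s₁ 2 , ≤-refl) adm (start s₁)) ,
  (λ u → let s = proj₁ (t-stable u) in 2 + s , start s , λ t t₀<t adm →
    proj₂ (t-stable u) (≤-trans (m≤n+m s 2) (<⇒≤ t₀<t) , refl) (m≤n+m s 2 , refl) adm (start s)) ,
  (λ t adm → proj₁ (u-stable t) , λ u u₀<u →
    proj₂ (u-stable t) (refl , <⇒≤ u₀<u) (refl , ≤-refl) adm adm)
  where
  open Cover a α β γ 1≤a 1≤α

  start : ∀ s → Admissible a α β (2 + s)
  start s = admissible β 1≤a 1≤α (s≤s (s≤s z≤n))

  tu-stable = stabilization both-large
  s₁ = proj₁ tu-stable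
  t-stable = λ u → stabilization (t-large u)
  u-stable = λ t → stabilization (u-large t)
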